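{- Let $d\ge 5$ be an integer and let $G$ be a $2$-connected graph with minimum degree $\delta(G)\ge d$. If $|V(G)|\ge 2d$, then $G$ has a removable $d$-matching, i.e. there is a matching $M$ of $G$ with $|M|=d$ such that $G-M$ is $2$-connected.
   Context: All graphs are finite, undirected and simple. A graph is $2$-connected if it has at least three vertices, is connected, and has no cut-vertex. For $F\subseteq E(G)$, $G-F$ denotes the graph obtained from $G$ by deleting the edges in $F$ (keeping all vertices). A matching $M$ (a set of pairwise disjoint edges) of a $2$-connected graph $G$ is removable if $G-M$ is $2$-connected. An $\ell$-matching is a matching of size $\ell$. -}

module Defs where

open import Data.Nat.Base using (ℕ; _≤_)
open import Data.Fin.Base using (Fin)
open import Data.Fin.Properties using (_≟_)
open import Data.Fin.Subset using (Subset; ∣_∣)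
open import Data.List.Base using (List; length; map; allFin)
open import Data.List.Extrema.Nat using (min)
open import Data.List.Membership.Propositional using (_∉_)
import Data.List.Membership.DecPropositional as DecMembership
open import Data.List.Relation.Unary.All using (All)
open import Data.List.Relation.Unary.AllPairs using (AllPairs)
open import Data.Product.Base using (_×_; _,_; ∃₂)
open import Data.Product.Properties using (≡-dec)
open import Data.Vec.Base using (tabulate)
open import Level using (0ℓ)
open import Relation.Binary.Core using (Rel)
open import Relation.Binary.Construct.Closure.ReflexiveTransitive using (Star)
open import Relation.Binary.Definitions using (Decidable; Symmetric)
open import Relation.Binary.PropositionalEquality using (_≡_; _≢_)
open import Relation.Nullary.Decidable using (does; _×-dec_; ¬?)
open import Relation.Nullary.Negation using (¬_)

record Graph (n : ℕ) : Set₁ where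
  field
    Adj    : Rel (Fin n) 0ℓ
    adj?   : Decidable Adj
    sym    : Symmetric Adj
    irrefl : ∀ {v} → ¬ Adj v v

open Graph public

∣V_∣ : ∀ {n} → Graph n → ℕ
∣V_∣ {n} _ = n

neighbours : ∀ {n} → Graph n → Fin n → Subset n
neighbours G v = tabulate (λ w → does (adj? G v w))

degree : ∀ {n} → Graph n → Fin n → ℕ
degree G v = ∣ neighbours G v ∣

-- The first argument of min is included in the minimum; every degree is
-- smaller than n, so n never affects the value when there is a vertex.
δ : ∀ {n} → Graph n → ℕ
δ {n} G = min n (map (degree G) (allFin n))

Connected : ∀ {n} → Graph n → Set
Connected G = ∀ u w → Star (Adj G) u w

-- Adjacency of the graph obtained by deleting the vertex v.  It is still a
-- relation on Fin n, so v itself has to be excluded wherever it is used.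
AdjWithout : ∀ {n} → Graph n → Fin n → Rel (Fin n) 0ℓ
AdjWithout G v u w = u ≢ v × w ≢ v × Adj G u w

-- Deleting v separates two other vertices of the same component, that is,
-- it increases the number of components.
CutVertex : ∀ {n} → Graph n → Fin n → Set
CutVertex G v = ∃₂ λ u w →
  u ≢ v × w ≢ v × Star (Adj G) u w × ¬ Star (AdjWithout G v) u w

record TwoConnected {n : ℕ} (G : Graph n) : Set where
  field
    atLeast3    : 3 ≤ ∣V G ∣
    connected   : Connected G
    noCutVertex : ∀ v → ¬ CutVertex G v

-- The pair (u , w) stands for the undirected edge uw, as does (w , u).
EdgeList : ℕ → Set
EdgeList n = List (Fin n × Fin n)

infixl 6 _-ᴱ_

_-ᴱ_ : ∀ {n} → Graph n → EdgeList n → Graph n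
G -ᴱ F = record
  { Adj    = λ u w → Adj G u w × (u , w) ∉ F × (w , u) ∉ F
  ; adj?   = λ u w → adj? G u w ×-dec ¬? ((u , w) ∈? F) ×-dec ¬? ((w , u) ∈? F)
  ; sym    = λ (a , p , q) → sym G a , q , p
  ; irrefl = λ (a , _) → irrefl G a
  }
  where open DecMembership (≡-dec _≟_ _≟_) using (_∈?_)

Disjoint : ∀ {n} → Rel (Fin n × Fin n) 0ℓ
Disjoint (u , w) (x , y) = u ≢ x × u ≢ y × w ≢ x × w ≢ y

-- Disjoint edges are different edges, so a matching lists each of its edges
-- once and its length is its size.
record Matching {n : ℕ} (G : Graph n) (M : EdgeList n) : Set where
  field
    edges    : All (λ (u , w) → Adj G u w) M
    disjoint : AllPairs Disjoint M

record ℓ-Matching {n : ℕ} (ℓ : ℕ) (G : Graph n) (M : EdgeList n) : Set where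
  field
    matching : Matching G M
    size     : length M ≡ ℓ

Removable : ∀ {n} → Graph n → EdgeList n → Set
Removable G M = TwoConnected (G -ᴱ M)

{-# OPTIONS --safe #-}
-- A removable matching M with fewer than d edges can always be enlarged.  Put H = G - M and call
-- the vertices missed by M free.  If H - xy is not 2-connected for an edge xy of H, then some vertex
-- c separates x from y in H - xy, and the two sides are "ends": vertex sets A that are left only
-- by xy and by edges to c.  Uncrossing shows that each end includes an end A such that every
-- edge of H inside A ∪ {c} can be deleted.  If M cannot be enlarged, such an A ∪ {c} contains no
-- edge between free vertices, so the minimum degree forces A to contain at least d - 2 covered
-- vertices.  There are at most 2d - 2 covered vertices, so three disjoint ends are impossible
-- for d ≥ 5, and two disjoint ends use up almost all of them.  In this tight situation, and
-- likewise when there is no end at all, counting produces an edge ab of M and free vertices u, v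
-- such that M - ab + ua + vb is removable.

module Submission where

open import Defs
open import Data.Bool.Base using (Bool; true; false; if_then_else_)
open import Data.Empty using (⊥; ⊥-elim)
open import Data.Fin.Base using (Fin; zero; suc)
open import Data.Fin.Properties using (_≟_; any?)
open import Data.Fin.Subset using (∣_∣)
open import Data.List.Base using (List; []; _∷_; length; foldr)
open import Data.List.Extrema.Nat using (min≤xs)
import Data.List.Membership.DecPropositional as DecMembership
open import Data.List.Membership.Propositional using (_∈_; _∉_; find)
open import Data.List.Membership.Propositional.Properties using (∈-map⁺; ∈-allFin)
open import Data.List.Relation.Unary.All using (All; []; _∷_)
import Data.List.Relation.Unary.All as All
open import Data.List.Relation.Unary.AllPairs using (AllPairs; []; _∷_; allPairs?)
open import Data.List.Relation.Unary.Any using (Any; here; there)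
import Data.List.Relation.Unary.Any as Any
open import Data.Nat.Base using (ℕ; zero; suc; _+_; _*_; _≤_; _<_; _≥_; z≤n; s≤s; s≤s⁻¹)
open import Data.Nat.Properties
  using (+-0-monoid; +-0-commutativeMonoid; +-comm; +-assoc; +-suc; +-identityʳ;
    +-mono-≤; +-monoʳ-≤; +-monoˡ-≤; +-monoʳ-<; ≤-refl; ≤-reflexive; ≤-trans; <⇒≱;
    ≰⇒>; ≮⇒≥; <-irrefl; m≤n+m; n≤1+n; module ≤-Reasoning; _≤?_)
open import Data.Nat.Tactic.RingSolver using (solve-∀)
open import Data.Product.Properties using (≡-dec)
open import Data.Product.Base using (_×_; _,_; ∃; ∃₂; proj₁; proj₂; ∃-syntax; Σ-syntax)
open import Data.Sum.Base using (_⊎_; inj₁; inj₂; [_,_]′; swap)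
open import Data.Unit.Base using (⊤; tt)
open import Data.Vec.Base using (tabulate)
open import Function.Base using (_∘_; case_of_)
open import Level using (0ℓ)
open import Relation.Binary.Construct.Closure.ReflexiveTransitive using (Star; ε; _◅_; _◅◅_)
import Relation.Binary.Construct.Closure.ReflexiveTransitive as Star
open import Relation.Binary.Core using (Rel)
open import Relation.Binary.Definitions using (Decidable)
open import Relation.Binary.PropositionalEquality
  using (_≡_; _≢_; refl; cong; subst; ≢-sym)
  renaming (sym to ≡-sym; trans to ≡-trans)
open import Relation.Nullary.Decidable using (Dec; yes; no; does; _×-dec_; _⊎-dec_; ¬?; map′; decidable-stable)
open import Relation.Nullary.Negation using (¬_; contradiction)
open import Algebra.Properties.CommutativeMonoid.Sum +-0-commutativeMonoid
  using (sum; ∑-distrib-+)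
open import Algebra.Properties.Monoid.Sum +-0-monoid
  using (sum-replicate-zero)

-- The same inequality 3(d - 2) > 2d - 2, that is d ≥ 5, excludes three disjoint ends and later
-- finds a matching edge on which an exchange can act. The bound |V| ≥ 2d leaves two free vertices,
-- and also a vertex outside A ∪ A′ ∪ {c} when |A|, |A′| ≤ d - 1. The obstacle is that two disjoint
-- ends demand only 2(d - 2) covered vertices, two fewer than the budget, so counting alone cannot
-- exclude them. Each further fact (a covered attachment vertex, an end without free vertices, an
-- end with at least d vertices) uses up a unit of this slack, and exchanges dispose of the rest. An
-- exchange for which au and bv are separately deletable can fail only at a cut with a, b on one
-- side and u, v on the other, since ab is put back. One further edge of H across that cut refutes
-- it: bu when u is adjacent to both a and b, or an edge near one end when a and b lie in different
-- ends. Connectivity is handled through `Crossed`, so that every such argument follows a single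
-- edge leaving a set.

private variable n : ℕ

-- Decidable vertex sets and their cardinalities

record DSet (n : ℕ) : Set₁ where
  infix 4 _∋_ _∋?_
  field
    _∋_  : Fin n → Set
    _∋?_ : ∀ v → Dec (_∋_ v)

open DSet public

infix  4 _⊆_
infixl 6 _∪_ _∖_ _-_
infixl 7 _∩_

_⊆_ : DSet n → DSet n → Set
P ⊆ Q = ∀ {v} → P ∋ v → Q ∋ v

_∪_ _∩_ _∖_ : DSet n → DSet n → DSet n
P ∪ Q = record { _∋_ = λ v → P ∋ v ⊎ Q ∋ v ; _∋?_ = λ v → (P ∋? v) ⊎-dec (Q ∋? v) }
P ∩ Q = record { _∋_ = λ v → P ∋ v × Q ∋ v ; _∋?_ = λ v → (P ∋? v) ×-dec (Q ∋? v) }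
P ∖ Q = record { _∋_ = λ v → P ∋ v × ¬ Q ∋ v ; _∋?_ = λ v → (P ∋? v) ×-dec ¬? (Q ∋? v) }

full : DSet n
full = record { _∋_ = λ _ → ⊤ ; _∋?_ = λ _ → yes tt }

⁅_⁆ : Fin n → DSet n
⁅ a ⁆ = record { _∋_ = λ v → v ≡ a ; _∋?_ = λ v → v ≟ a }

_-_ : DSet n → Fin n → DSet n
P - a = P ∖ ⁅ a ⁆

N : Graph n → Fin n → DSet n
N G v = record { _∋_ = Adj G v ; _∋?_ = adj? G v }

ind : DSet n → Fin n → ℕ
ind P v = if does (P ∋? v) then 1 else 0

card : DSet n → ℕ
card P = sum (ind P)

ind-∈ : ∀ (P : DSet n) {v} → P ∋ v → ind P v ≡ 1
ind-∈ P {v} v∈P with P ∋? v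
... | yes _   = refl
... | no  v∉P = contradiction v∈P v∉P

ind≤1 : ∀ (P : DSet n) v → ind P v ≤ 1
ind≤1 P v with P ∋? v
... | yes _ = ≤-refl
... | no  _ = z≤n

∣tabulate∣ : ∀ {n} (f : Fin n → Bool) → ∣ tabulate f ∣ ≡ sum (λ v → if f v then 1 else 0)
∣tabulate∣ {zero}  f = refl
∣tabulate∣ {suc n} f with f zero
... | true  = cong suc (∣tabulate∣ (f ∘ suc))
... | false = ∣tabulate∣ (f ∘ suc)

degree≡card : ∀ (G : Graph n) v → degree G v ≡ card (N G v)
degree≡card G v = ∣tabulate∣ (λ w → does (adj? G v w))

sum-mono : ∀ {n} {f g : Fin n → ℕ} → (∀ v → f v ≤ g v) → sum f ≤ sum g
sum-mono {zero}  f≤g = z≤n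
sum-mono {suc n} f≤g = +-mono-≤ (f≤g zero) (sum-mono (f≤g ∘ suc))

card-cover : ∀ (P Q R : DSet n) → (∀ v → P ∋ v → Q ∋ v ⊎ R ∋ v) → card P ≤ card Q + card R
card-cover P Q R P⊆ = begin
  sum (ind P)                     ≤⟨ sum-mono pointwise ⟩
  sum (λ v → ind Q v + ind R v)   ≡⟨ ∑-distrib-+ (ind Q) (ind R) ⟩
  card Q + card R                 ∎
  where
  open ≤-Reasoning
  pointwise : ∀ v → ind P v ≤ ind Q v + ind R v
  pointwise v with P ∋? v | Q ∋? v | R ∋? v
  ... | no _    | _       | _       = z≤n
  ... | yes _   | yes _   | _       = s≤s z≤n
  ... | yes _   | no _    | yes _   = s≤s z≤n
  ... | yes v∈P | no v∉Q  | no v∉R  = contradiction (P⊆ v v∈P) [ v∉Q , v∉R ]′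

card-pack : ∀ (P Q R : DSet n) → Q ⊆ P → R ⊆ P → (∀ v → Q ∋ v → ¬ R ∋ v) →
  card Q + card R ≤ card P
card-pack P Q R Q⊆P R⊆P disj = begin
  card Q + card R                 ≡⟨ ≡-sym (∑-distrib-+ (ind Q) (ind R)) ⟩
  sum (λ v → ind Q v + ind R v)   ≤⟨ sum-mono pointwise ⟩
  sum (ind P)                     ∎
  where
  open ≤-Reasoning
  pointwise : ∀ v → ind Q v + ind R v ≤ ind P v
  pointwise v with Q ∋? v | R ∋? v
  ... | no _    | no _    = z≤n
  ... | yes v∈Q | yes v∈R = contradiction v∈R (disj v v∈Q)
  ... | yes v∈Q | no _    = ≤-reflexive (≡-sym (ind-∈ P (Q⊆P v∈Q)))
  ... | no _    | yes v∈R = ≤-reflexive (≡-sym (ind-∈ P (R⊆P v∈R)))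

card-⊆ : ∀ (P Q : DSet n) → P ⊆ Q → card P ≤ card Q
card-⊆ P Q P⊆Q = sum-mono pointwise
  where
  pointwise : ∀ v → ind P v ≤ ind Q v
  pointwise v with P ∋? v
  ... | no _    = z≤n
  ... | yes v∈P = ≤-reflexive (≡-sym (ind-∈ Q (P⊆Q v∈P)))

card-⁅⁆ : ∀ {n} (a : Fin n) → card ⁅ a ⁆ ≡ 1
card-⁅⁆ {suc n} zero    = cong suc (sum-replicate-zero n)
card-⁅⁆         (suc a) = card-⁅⁆ a

card≤suc : ∀ (P Q : DSet n) a → (∀ v → P ∋ v → v ≢ a → Q ∋ v) → card P ≤ suc (card Q)
card≤suc P Q a P⊆ = begin
  card P              ≤⟨ card-cover P ⁅ a ⁆ Q split ⟩
  card ⁅ a ⁆ + card Q ≡⟨ cong (_+ card Q) (card-⁅⁆ a) ⟩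
  suc (card Q)        ∎
  where
  open ≤-Reasoning
  split : ∀ v → P ∋ v → v ≡ a ⊎ Q ∋ v
  split v v∈P with v ≟ a
  ... | yes v≡a = inj₁ v≡a
  ... | no  v≢a = inj₂ (P⊆ v v∈P v≢a)

card≤suc² : ∀ (P Q : DSet n) a b → (∀ v → P ∋ v → v ≢ a → v ≢ b → Q ∋ v) →
  card P ≤ suc (suc (card Q))
card≤suc² P Q a b P⊆ = ≤-trans
  (card≤suc P (P - a) a (λ v v∈P v≢a → v∈P , v≢a))
  (s≤s (card≤suc (P - a) Q b (λ v (v∈P , v≢a) → P⊆ v v∈P v≢a)))

card-strict : ∀ (P Q : DSet n) a → P ⊆ Q → Q ∋ a → ¬ P ∋ a → card P < card Q
card-strict P Q a P⊆Q a∈Q a∉P =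
  subst (λ s → s + card P ≤ card Q) (card-⁅⁆ a)
    (card-pack Q ⁅ a ⁆ P (λ { refl → a∈Q }) P⊆Q (λ { v refl → a∉P }))

card-strict² : ∀ (P Q : DSet n) a b → a ≢ b → P ⊆ Q → Q ∋ a → Q ∋ b → ¬ P ∋ a → ¬ P ∋ b →
  suc (suc (card P)) ≤ card Q
card-strict² P Q a b a≢b P⊆Q a∈Q b∈Q a∉P b∉P = ≤-trans
  (s≤s (card-strict P (Q - b) a (λ v∈P → P⊆Q v∈P , λ { refl → b∉P v∈P }) (a∈Q , a≢b) a∉P))
  (card-strict (Q - b) Q b proj₁ b∈Q (λ (_ , b≢b) → b≢b refl))

card-pick : ∀ (P Q : DSet n) → card Q < card P → ∃ λ v → P ∋ v × ¬ Q ∋ v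
card-pick P Q Q<P with any? (λ v → (P ∋? v) ×-dec ¬? (Q ∋? v))
... | yes found = found
... | no  none  = contradiction (card-⊆ P Q P⊆Q) (<⇒≱ Q<P)
  where
  P⊆Q : P ⊆ Q
  P⊆Q {v} v∈P with Q ∋? v
  ... | yes v∈Q = v∈Q
  ... | no  v∉Q = contradiction (v , v∈P , v∉Q) none

card-tight : ∀ (P Q : DSet n) → P ⊆ Q → card Q ≤ card P → Q ⊆ P
card-tight P Q P⊆Q Q≤P {v} v∈Q with P ∋? v
... | yes v∈P = v∈P
... | no  v∉P = contradiction Q≤P (<⇒≱ (card-strict P Q v P⊆Q v∈Q v∉P))

card-full : ∀ n → card (full {n}) ≡ n
card-full zero    = refl
card-full (suc n) = cong suc (card-full n)

-- Edge weights

_without_ : (Fin n → ℕ) → Fin n → Fin n → ℕ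
(w without a) v = if does (a ≟ v) then 0 else w v

without-≡ : ∀ (w : Fin n → ℕ) a → (w without a) a ≡ 0
without-≡ w a with a ≟ a
... | yes _  = refl
... | no a≢a = contradiction refl a≢a

without-≤ : ∀ (w : Fin n → ℕ) a v → (w without a) v ≤ w v
without-≤ w a v with a ≟ v
... | yes _ = z≤n
... | no  _ = ≤-refl

sum-without : ∀ {n} (w : Fin n → ℕ) a → sum w ≤ w a + sum (w without a)
sum-without {suc n} w zero    = ≤-refl
sum-without {suc n} w (suc a) = begin
  w zero + sum (w ∘ suc)                                ≤⟨ +-monoʳ-≤ (w zero) (sum-without (w ∘ suc) a) ⟩
  w zero + (w (suc a) + sum ((w ∘ suc) without a))      ≡⟨ ≡-sym (+-assoc (w zero) _ _) ⟩
  w zero + w (suc a) + sum ((w ∘ suc) without a)        ≡⟨ cong (_+ sum ((w ∘ suc) without a)) (+-comm (w zero) _) ⟩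
  w (suc a) + w zero + sum ((w ∘ suc) without a)        ≡⟨ +-assoc (w (suc a)) _ _ ⟩
  w (suc a) + (w zero + sum ((w ∘ suc) without a))      ∎
  where open ≤-Reasoning

Covered : EdgeList n → Fin n → Set
Covered M v = Any (λ (a , b) → v ≡ a ⊎ v ≡ b) M

weight : (Fin n → ℕ) → EdgeList n → ℕ
weight w = foldr (λ (a , b) s → w a + w b + s) 0

weight-mono : ∀ {w w′ : Fin n → ℕ} → (∀ v → w v ≤ w′ v) → ∀ M → weight w M ≤ weight w′ M
weight-mono w≤ []            = z≤n
weight-mono w≤ ((a , b) ∷ M) = +-mono-≤ (+-mono-≤ (w≤ a) (w≤ b)) (weight-mono w≤ M)

-- Zeroing `w` at both ends of the head edge leaves a function supported on what the tail covers;
-- the head edge pays for the two values removed.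
sum≤weight : ∀ (w : Fin n → ℕ) M → (∀ v → w v ≡ 0 ⊎ Covered M v) → sum w ≤ weight w M
sum≤weight {n} w [] cov = ≤-trans (sum-mono {g = λ _ → 0} zeros) (≤-reflexive (sum-replicate-zero n))
  where
  zeros : ∀ v → w v ≤ 0
  zeros v with cov v
  ... | inj₁ w≡0 = ≤-reflexive w≡0
sum≤weight w ((a , b) ∷ M) cov = begin
  sum w                                    ≤⟨ sum-without w a ⟩
  w a + sum (w without a)                  ≤⟨ +-monoʳ-≤ (w a) (sum-without (w without a) b) ⟩
  w a + ((w without a) b + sum w′)         ≤⟨ +-monoʳ-≤ (w a) (+-mono-≤ (without-≤ w a b) (sum≤weight w′ M cov′)) ⟩
  w a + (w b + weight w′ M)                ≤⟨ +-monoʳ-≤ (w a) (+-monoʳ-≤ (w b) (weight-mono w′≤w M)) ⟩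
  w a + (w b + weight w M)                 ≡⟨ ≡-sym (+-assoc (w a) _ _) ⟩
  w a + w b + weight w M                   ∎
  where
  open ≤-Reasoning
  w′ = (w without a) without b
  w′≤w : ∀ v → w′ v ≤ w v
  w′≤w v = ≤-trans (without-≤ (w without a) b v) (without-≤ w a v)
  zero-below : ∀ {i j} → i ≤ j → j ≡ 0 → i ≡ 0
  zero-below z≤n refl = refl
  cov′ : ∀ v → w′ v ≡ 0 ⊎ Covered M v
  cov′ v with cov v
  ... | inj₁ w≡0 = inj₁ (zero-below (w′≤w v) w≡0)
  ... | inj₂ (there v∈M) = inj₂ v∈M
  ... | inj₂ (here (inj₁ refl)) = inj₁ (zero-below (without-≤ (w without v) b v) (without-≡ w v))
  ... | inj₂ (here (inj₂ refl)) = inj₁ (without-≡ (w without a) v)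

-- Pigeonhole: edges of weight at most 2 would total at most twice their number.
heavy-edge : ∀ (w : Fin n → ℕ) M → length M + length M < weight w M →
  Any (λ (a , b) → 3 ≤ w a + w b) M
heavy-edge w ((a , b) ∷ M) 2∣M∣< with 3 ≤? w a + w b
... | yes 3≤ = here 3≤
... | no  3≰ = there (heavy-edge w M (s≤s⁻¹ (s≤s⁻¹ (begin-strict
  suc (suc (length M + length M))   ≡⟨ cong suc (≡-sym (+-suc (length M) _)) ⟩
  suc (length M) + suc (length M)   <⟨ 2∣M∣< ⟩
  w a + w b + weight w M            ≤⟨ +-monoˡ-≤ (weight w M) (s≤s⁻¹ (≰⇒> 3≰)) ⟩
  suc (suc (weight w M))            ∎))))
  where open ≤-Reasoning

weight≤2 : ∀ (w : Fin n → ℕ) → (∀ v → w v ≤ 1) → ∀ M → weight w M ≤ length M + length M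
weight≤2 w w≤1 []            = z≤n
weight≤2 w w≤1 ((a , b) ∷ M) = ≤-trans
  (+-mono-≤ (+-mono-≤ (w≤1 a) (w≤1 b)) (weight≤2 w w≤1 M))
  (≤-reflexive (cong suc (≡-sym (+-suc (length M) _))))

-- Connectivity through cuts

-- 2-connectedness in terms of cuts: whenever a vertex t is deleted, an edge
-- joins any two complementary sets of remaining vertices.
Crossed : Graph n → Set₁
Crossed {n} K = ∀ t (P : DSet n) {p q} → ¬ P ∋ t → P ∋ p → ¬ P ∋ q → q ≢ t →
  ∃₂ λ r s → P ∋ r × ¬ P ∋ s × s ≢ t × Adj K r s

-- The negation of `Crossed` as explicit data: failure of 2-connectedness hands over the cut and the
-- deleted vertex.
record Uncrossed (K : Graph n) : Set₁ where
  field
    t p q   : Fin n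
    P       : DSet n
    t∉P     : ¬ P ∋ t
    p∈P     : P ∋ p
    q∉P     : ¬ P ∋ q
    q≢t     : q ≢ t
    no-edge : ∀ {r s} → P ∋ r → ¬ P ∋ s → s ≢ t → ¬ Adj K r s

crossed⇒¬uncrossed : ∀ {K : Graph n} → Crossed K → ¬ Uncrossed K
crossed⇒¬uncrossed cr un =
  let open Uncrossed un
      (_ , _ , r∈P , s∉P , s≢t , rs) = cr t P t∉P p∈P q∉P q≢t
  in no-edge r∈P s∉P s≢t rs

record Reachable (R : Rel (Fin n) 0ℓ) (u : Fin n) : Set₁ where
  field
    P       : DSet n
    u∈P     : P ∋ u
    reached : ∀ {v} → P ∋ v → Star R u v
    closed  : ∀ {r s} → P ∋ r → R r s → P ∋ s

-- While some step leaves `P`, its target is added. Each addition pays for one unit of the fuel `m`,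
-- so `n ≤ card P + m` persists.
reachable : ∀ {R : Rel (Fin n) 0ℓ} → Decidable R → ∀ u → Reachable R u
reachable {n} {R} R? u = grow n ⁅ u ⁆ refl (λ { refl → ε }) (m≤n+m n _)
  where
  grow : ∀ m (P : DSet n) → P ∋ u → (∀ {v} → P ∋ v → Star R u v) → n ≤ card P + m → Reachable R u
  grow m P u∈P reached bound
    with any? (λ r → any? (λ s → (P ∋? r) ×-dec ¬? (P ∋? s) ×-dec R? r s))
  ... | no none = record
    { P = P ; u∈P = u∈P ; reached = reached
    ; closed = λ {r} {s} r∈P rs → case P ∋? s of λ where
        (yes s∈P) → s∈P
        (no  s∉P) → contradiction (r , s , r∈P , s∉P , rs) none }
  grow zero P u∈P reached bound | yes (r , s , r∈P , s∉P , rs) =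
    contradiction bound (<⇒≱ (begin-strict
      card P + 0 ≡⟨ +-identityʳ _ ⟩
      card P     <⟨ card-strict P (full {n}) s _ _ s∉P ⟩
      card {n} full  ≡⟨ card-full n ⟩
      n          ∎))
    where
    open ≤-Reasoning
  grow (suc m) P u∈P reached bound | yes (r , s , r∈P , s∉P , rs) =
    grow m (P ∪ ⁅ s ⁆) (inj₁ u∈P)
      (λ { (inj₁ v∈P) → reached v∈P ; (inj₂ refl) → reached r∈P ◅◅ rs ◅ ε })
      (begin
        n                        ≤⟨ bound ⟩
        card P + suc m           ≡⟨ +-suc (card P) m ⟩
        suc (card P) + m         ≤⟨ +-monoˡ-≤ m (card-strict P (P ∪ ⁅ s ⁆) s inj₁ (inj₂ refl) s∉P) ⟩
        card (P ∪ ⁅ s ⁆) + m     ∎)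
    where open ≤-Reasoning

adjWithout? : ∀ (K : Graph n) t → Decidable (AdjWithout K t)
adjWithout? K t u w = ¬? (u ≟ t) ×-dec ¬? (w ≟ t) ×-dec adj? K u w

crossing-step : ∀ {R : Rel (Fin n) 0ℓ} (P : DSet n) {p q} → Star R p q → P ∋ p → ¬ P ∋ q →
  ∃₂ λ r s → P ∋ r × ¬ P ∋ s × R r s
crossing-step P ε p∈P q∉P = contradiction p∈P q∉P
crossing-step P (_◅_ {j = s} rs walk) p∈P q∉P with P ∋? s
... | yes s∈P = crossing-step P walk s∈P q∉P
... | no  s∉P = _ , _ , p∈P , s∉P , rs

walks⇒crossed : ∀ {K : Graph n} →
  (∀ t {u w} → u ≢ t → w ≢ t → Star (AdjWithout K t) u w) → Crossed K
walks⇒crossed walks t P {p} t∉P p∈P q∉P q≢t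
  with crossing-step P (walks t (λ { refl → t∉P p∈P }) q≢t) p∈P q∉P
... | r , s , r∈P , s∉P , (_ , s≢t , rs) = r , s , r∈P , s∉P , s≢t , rs

avoids : ∀ (K : Graph n) {t u v} → u ≢ t → Star (AdjWithout K t) u v → v ≢ t
avoids K u≢t ε = u≢t
avoids K _   ((_ , s≢t , _) ◅ walk) = avoids K s≢t walk

module _ (K : Graph n) where

  private
    reach : ∀ t u → Reachable (AdjWithout K t) u
    reach t u = reachable (adjWithout? K t) u

  -- The set reachable from `u` in K - t is closed under edges avoiding `t`, so it is itself an
  -- uncrossed set.
  missed-vertex : ∀ {t u w} → u ≢ t → w ≢ t → ¬ Reachable.P (reach t u) ∋ w → Uncrossed K
  missed-vertex {t} {u} {w} u≢t w≢t w∉P = record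
    { P = P ; t∉P = λ t∈P → avoids K u≢t (reached t∈P) refl
    ; p∈P = u∈P ; q∉P = w∉P ; q≢t = w≢t
    ; no-edge = λ r∈P s∉P s≢t rs →
        s∉P (closed r∈P (avoids K u≢t (reached r∈P) , s≢t , rs)) }
    where open Reachable (reach t u)

  crossed⇒walks : Crossed K → ∀ t {u w} → u ≢ t → w ≢ t → Star (AdjWithout K t) u w
  crossed⇒walks cr t {u} {w} u≢t w≢t with Reachable.P (reach t u) ∋? w
  ... | yes w∈P = Reachable.reached (reach t u) w∈P
  ... | no  w∉P = contradiction (missed-vertex u≢t w≢t w∉P) (crossed⇒¬uncrossed cr)

  crossed-or-not : Crossed K ⊎ Uncrossed K
  crossed-or-not with any? (λ t → any? (λ u → any? (λ w →
      ¬? (u ≟ t) ×-dec ¬? (w ≟ t) ×-dec ¬? (Reachable.P (reach t u) ∋? w))))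
  ... | yes (_ , _ , _ , u≢t , w≢t , w∉P) = inj₂ (missed-vertex u≢t w≢t w∉P)
  ... | no  none = inj₁ (walks⇒crossed {K = K} λ t {u} {w} u≢t w≢t →
    case Reachable.P (reach t u) ∋? w of λ where
      (yes w∈P) → Reachable.reached (reach t u) w∈P
      (no  w∉P) → contradiction (t , u , w , u≢t , w≢t , w∉P) none)

-- An uncrossed `P` traps every walk from `p` that avoids `t`, although `p` and `q` are connected in
-- `K`; so `t` would be a cut-vertex.
twoConnected⇒crossed : ∀ {K : Graph n} → TwoConnected K → Crossed K
twoConnected⇒crossed {K = K} tc t P {p} {q} t∉P p∈P q∉P q≢t
  with any? (λ r → any? (λ s → (P ∋? r) ×-dec ¬? (P ∋? s) ×-dec ¬? (s ≟ t) ×-dec adj? K r s))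
... | yes found = found
... | no  none  = contradiction
  (p , q , (λ { refl → t∉P p∈P }) , q≢t , connected p q ,
   λ walk → let (r , s , r∈P , s∉P , _ , s≢t , rs) = crossing-step {R = AdjWithout K t} P walk p∈P q∉P
            in none (r , s , r∈P , s∉P , s≢t , rs))
  (noCutVertex t)
  where open TwoConnected tc

third-vertex : 3 ≤ n → ∀ (u w : Fin n) → ∃ λ t → t ≢ u × t ≢ w
third-vertex {n} 3≤n u w with any? (λ t → ¬? (t ≟ u) ×-dec ¬? (t ≟ w))
... | yes found = found
... | no  none  = contradiction (≤-trans 3≤n (begin
  n                              ≡⟨ ≡-sym (card-full n) ⟩
  card {n} full                  ≤⟨ card-cover full ⁅ u ⁆ ⁅ w ⁆ split ⟩
  card ⁅ u ⁆ + card ⁅ w ⁆        ≡⟨ cong (_+ card ⁅ w ⁆) (card-⁅⁆ u) ⟩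
  suc (card ⁅ w ⁆)               ≡⟨ cong suc (card-⁅⁆ w) ⟩
  2                              ∎)) λ { (s≤s (s≤s ())) }
  where
  open ≤-Reasoning
  split : ∀ v → ⊤ → v ≡ u ⊎ v ≡ w
  split v _ with v ≟ u | v ≟ w
  ... | yes v≡u | _       = inj₁ v≡u
  ... | _       | yes v≡w = inj₂ v≡w
  ... | no v≢u  | no v≢w  = contradiction (v , v≢u , v≢w) none

-- For connectedness, two vertices are joined by a walk avoiding some third vertex.
crossed⇒twoConnected : ∀ {K : Graph n} → 3 ≤ n → Crossed K → TwoConnected K
crossed⇒twoConnected {K = K} 3≤n cr = record
  { atLeast3    = 3≤n
  ; connected   = λ u w → let (t , t≢u , t≢w) = third-vertex 3≤n u w in
      Star.map (λ (_ , _ , rs) → rs) (crossed⇒walks K cr t (≢-sym t≢u) (≢-sym t≢w))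
  ; noCutVertex = λ t (u , w , u≢t , w≢t , _ , ¬walk) → ¬walk (crossed⇒walks K cr t u≢t w≢t) }

-- Ends

_-ₑ_ : Graph n → Fin n × Fin n → Graph n
K -ₑ e = K -ᴱ (e ∷ [])

deleted-keeps : ∀ {K : Graph n} {x y r s} → Adj K r s →
  ¬ (r ≡ x × s ≡ y) → ¬ (r ≡ y × s ≡ x) → Adj (K -ₑ (x , y)) r s
deleted-keeps rs ≢xy ≢yx =
  rs , (λ { (here refl) → ≢xy (refl , refl) }) , (λ { (here refl) → ≢yx (refl , refl) })

deleted-edge : ∀ {K : Graph n} {x y r s} → Adj K r s → ¬ Adj (K -ₑ (x , y)) r s →
  (r ≡ x × s ≡ y) ⊎ (r ≡ y × s ≡ x)
deleted-edge {K = K} {x} {y} {r} {s} rs ¬rs with r ≟ x ×-dec s ≟ y | r ≟ y ×-dec s ≟ x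
... | yes xy | _      = inj₁ xy
... | _      | yes yx = inj₂ yx
... | no ≢xy | no ≢yx = contradiction (deleted-keeps {K = K} rs ≢xy ≢yx) ¬rs

deleted-crossing : ∀ {K : Graph n} {x y} → Crossed (K -ₑ (x , y)) →
  ∀ t (P : DSet n) {p q} → ¬ P ∋ t → P ∋ p → ¬ P ∋ q → q ≢ t →
  ∃₂ λ r s → P ∋ r × ¬ P ∋ s × s ≢ t × Adj K r s × ¬ (r ≡ x × s ≡ y) × ¬ (r ≡ y × s ≡ x)
deleted-crossing cr t P t∉P p∈P q∉P q≢t with cr t P t∉P p∈P q∉P q≢t
... | r , s , r∈P , s∉P , s≢t , (rs , ≢xy , ≢yx) =
  r , s , r∈P , s∉P , s≢t , rs , (λ { (refl , refl) → ≢xy (here refl) }) , (λ { (refl , refl) → ≢yx (here refl) })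

-- The edge xy is the only edge that leaves A without going to c.  Such an A
-- exists exactly when deleting xy destroys 2-connectedness.
record End (K : Graph n) (A : DSet n) (x y c : Fin n) : Set where
  field
    x∈A    : A ∋ x
    y∉A    : ¬ A ∋ y
    c∉A    : ¬ A ∋ c
    y≢c    : y ≢ c
    xy     : Adj K x y
    leaves : ∀ {r s} → A ∋ r → ¬ A ∋ s → Adj K r s → s ≡ c ⊎ (r ≡ x × s ≡ y)

  x≢c : x ≢ c
  x≢c refl = c∉A x∈A

_opposite_ : DSet n → Fin n → DSet n
A opposite c = record
  { _∋_ = λ v → ¬ A ∋ v × v ≢ c ; _∋?_ = λ v → ¬? (A ∋? v) ×-dec ¬? (v ≟ c) }

-- The same edge, reversed, leaves the other side. This symmetry lets later arguments choose the
-- side that avoids a given vertex.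
flip-end : ∀ {K : Graph n} {A x y c} → End K A x y c → End K (A opposite c) y x c
flip-end {n} {K} {A} {x} {y} {c} e = record
  { x∈A = y∉A , y≢c ; y∉A = λ (x∉A , _) → x∉A x∈A ; c∉A = λ (_ , c≢c) → c≢c refl
  ; y≢c = x≢c ; xy = sym K xy ; leaves = leaves′ }
  where
  open End e
  leaves′ : ∀ {r s} → ¬ A ∋ r × r ≢ c → ¬ (¬ A ∋ s × s ≢ c) → Adj K r s → s ≡ c ⊎ (r ≡ y × s ≡ x)
  leaves′ {r} {s} (r∉A , r≢c) s∉ rs with s ≟ c | A ∋? s
  ... | yes s≡c | _       = inj₁ s≡c
  ... | no  s≢c | no  s∉A = contradiction (s∉A , s≢c) s∉
  ... | no  s≢c | yes s∈A with leaves s∈A r∉A (sym K rs)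
  ...   | inj₁ r≡c        = contradiction r≡c r≢c
  ...   | inj₂ (s≡x , r≡y) = inj₂ (r≡y , s≡x)

end⇒¬removable : ∀ {K : Graph n} {A x y c} → End K A x y c → ¬ Crossed (K -ₑ (x , y))
end⇒¬removable {K = K} {A} {c = c} e cr
  with deleted-crossing {K = K} cr c A (End.c∉A e) (End.x∈A e) (End.y∉A e) (End.y≢c e)
... | r , s , r∈A , s∉A , s≢c , rs , ≢xy , _ with End.leaves e r∈A s∉A rs
...   | inj₁ s≡c = s≢c s≡c
...   | inj₂ xy  = ≢xy xy

-- `K` itself is crossed, so some edge leaves `P`, and it can only be xy in one of its two
-- directions. In the wrong direction, the complement of `P` without `t` takes the place of `P`. The
-- attachment vertex is `t`.
¬removable⇒end : ∀ {K : Graph n} {x y} → Crossed K → Adj K x y → Uncrossed (K -ₑ (x , y)) →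
  ∃₂ λ A c → End K A x y c
¬removable⇒end {n} {K} {x} {y} cr xy un = oriented (cr t P t∉P p∈P q∉P q≢t)
  where
  open Uncrossed un
  deleted : ∀ {r s} → P ∋ r → ¬ P ∋ s → s ≢ t → Adj K r s → (r ≡ x × s ≡ y) ⊎ (r ≡ y × s ≡ x)
  deleted r∈P s∉P s≢t rs = deleted-edge {K = K} rs (no-edge r∈P s∉P s≢t)
  end : ∀ {x′ y′} → P ∋ x′ → ¬ P ∋ y′ → y′ ≢ t → Adj K x′ y′ →
    (∀ {r s} → P ∋ r → ¬ P ∋ s → s ≢ t → Adj K r s → (r ≡ x′ × s ≡ y′) ⊎ (r ≡ y′ × s ≡ x′)) →
    End K P x′ y′ t
  end {x′} {y′} x∈P y∉P y≢t x′y′ del = record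
    { x∈A = x∈P ; y∉A = y∉P ; c∉A = t∉P ; y≢c = y≢t ; xy = x′y′ ; leaves = leaves }
    where
    leaves : ∀ {r s} → P ∋ r → ¬ P ∋ s → Adj K r s → s ≡ t ⊎ (r ≡ x′ × s ≡ y′)
    leaves {r} {s} r∈P s∉P rs with s ≟ t
    ... | yes s≡t = inj₁ s≡t
    ... | no  s≢t with del r∈P s∉P s≢t rs
    ...   | inj₁ x′y′≡         = inj₂ x′y′≡
    ...   | inj₂ (refl , refl) = contradiction r∈P y∉P
  oriented : (∃₂ λ r s → P ∋ r × ¬ P ∋ s × s ≢ t × Adj K r s) → ∃₂ λ A c → End K A x y c
  oriented (r , s , r∈P , s∉P , s≢t , rs) with deleted r∈P s∉P s≢t rs
  ... | inj₁ (refl , refl) = P , t , end r∈P s∉P s≢t rs deleted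
  ... | inj₂ (refl , refl) = P opposite t , t ,
    flip-end {A = P} (end r∈P s∉P s≢t rs λ r∈P s∉P s≢t rs → [ inj₂ , inj₁ ]′ (deleted r∈P s∉P s≢t rs))

record EndIn (K : Graph n) (S : DSet n) : Set₁ where
  field
    {A}     : DSet n
    {x y c} : Fin n
    end     : End K A x y c
    inside  : A ⊆ S

InnerRemovable : Graph n → DSet n → Fin n → Set₁
InnerRemovable K A c = ∀ {z w} → A ∋ z ⊎ z ≡ c → A ∋ w ⊎ w ≡ c → Adj K z w → Crossed (K -ₑ (z , w))

-- Uncrossing and shrinking ends

module Ends {n : ℕ} (K : Graph n) (crossed : Crossed K)
  (third-neighbour : ∀ v a b → ∃ λ m → Adj K v m × m ≢ a × m ≢ b) where

  -- With `b` deleted, something still leaves `P`, and it must be xy; hence `x` is in `P`. If `x`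
  -- were `a`, a third neighbour of `a` would lie in `P`, and deleting `a` would leave `P - a`
  -- without any exit. So `a` survives in `P - x`, which is left only by ab and by edges to the new
  -- attachment vertex `x`.
  two-exits : ∀ (P : DSet n) {a b x y q} → P ∋ a → ¬ P ∋ b → Adj K a b → ¬ P ∋ q → q ≢ b →
    (∀ {r s} → P ∋ r → ¬ P ∋ s → Adj K r s → (r ≡ a × s ≡ b) ⊎ (r ≡ x × s ≡ y)) →
    P ∋ x × End K (P - x) a b x
  two-exits P {a} {b} {x} {y} {q} a∈P b∉P ab q∉P q≢b exits = x∈P , record
    { x∈A = a∈P , a≢x ; y∉A = λ (b∈P , _) → b∉P b∈P ; c∉A = λ (_ , x≢x) → x≢x refl
    ; y≢c = λ { refl → b∉P x∈P } ; xy = ab ; leaves = leaves }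
    where
    x∈P : P ∋ x
    x∈P with crossed b P b∉P a∈P q∉P q≢b
    ... | r , s , r∈P , s∉P , s≢b , rs with exits r∈P s∉P rs
    ...   | inj₁ (_ , s≡b)  = contradiction s≡b s≢b
    ...   | inj₂ (refl , _) = r∈P

    leaves : ∀ {r s} → (P - x) ∋ r → ¬ (P - x) ∋ s → Adj K r s → s ≡ x ⊎ (r ≡ a × s ≡ b)
    leaves {r} {s} (r∈P , r≢x) s∉ rs with s ≟ x
    ... | yes s≡x = inj₁ s≡x
    ... | no  s≢x with exits r∈P (λ s∈P → s∉ (s∈P , s≢x)) rs
    ...   | inj₁ ab≡       = inj₂ ab≡
    ...   | inj₂ (r≡x , _) = contradiction r≡x r≢x

    a≢x : a ≢ x
    a≢x refl with third-neighbour a b y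
    ... | m , am , m≢b , m≢y
      with crossed a (P - a) {m} {b} (λ (_ , a≢a) → a≢a refl)
             (m∈P , λ { refl → irrefl K am }) (λ (b∈P , _) → b∉P b∈P) (λ { refl → b∉P a∈P })
      where
      m∈P : P ∋ m
      m∈P with P ∋? m
      ... | yes m∈P = m∈P
      ... | no  m∉P with exits a∈P m∉P am
      ...   | inj₁ (_ , m≡b) = contradiction m≡b m≢b
      ...   | inj₂ (_ , m≡y) = contradiction m≡y m≢y
    ... | r , s , r∈ , s∉ , s≢a , rs with leaves r∈ s∉ rs
    ...   | inj₁ s≡a       = s≢a s≡a
    ...   | inj₂ (r≡a , _) = proj₂ r∈ r≡a

  Smaller : DSet n → Set₁
  Smaller A = Σ[ E ∈ EndIn K A ] card (EndIn.A E) < card A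

  smaller : ∀ {A A′ x y c a} → End K A′ x y c → A′ ⊆ A → A ∋ a → ¬ A′ ∋ a → Smaller A
  smaller {A} {A′} {a = a} e A′⊆A a∈A a∉A′ =
    record { end = e ; inside = A′⊆A } , card-strict A′ A a A′⊆A a∈A a∉A′

  module _ {A x y c} (e : End K A x y c) where
    open End e

    private
      -- The set `A ∩ A′` is left only by zw and xy: an edge from it to `c′` leaves `A` and so is
      -- xy, while an edge to `c` leaves `A′` and is therefore covered by the same analysis. After
      -- `two-exits`, losing `x` makes the new end strictly smaller.
      uncross-outside : ∀ {A′ z w c′} → End K A′ z w c′ → A ∋ z ⊎ z ≡ c → A ∋ w ⊎ w ≡ c →
        ¬ A ∋ c′ → c′ ≢ c → ¬ A′ ∋ c → Smaller A
      uncross-outside {A′} {z} {w} {c′} e′ z∈ w∈ c′∉A c′≢c c∉A′ =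
        let (x∈P , e″) = two-exits (A ∩ A′) (z∈A , E′.x∈A) (λ (_ , w∈A′) → E′.y∉A w∈A′) E′.xy
                           (λ (c′∈A , _) → c′∉A c′∈A) (≢-sym E′.y≢c) exits
        in smaller e″ (λ v∈ → proj₁ (proj₁ v∈)) x∈A (λ (_ , x≢x) → x≢x refl)
        where
        module E′ = End e′
        z∈A : A ∋ z
        z∈A = [ (λ z∈A → z∈A) , (λ { refl → contradiction E′.x∈A c∉A′ }) ]′ z∈
        exits : ∀ {r s} → (A ∩ A′) ∋ r → ¬ (A ∩ A′) ∋ s → Adj K r s →
          (r ≡ z × s ≡ w) ⊎ (r ≡ x × s ≡ y)
        exits {r} {s} (r∈A , r∈A′) s∉ rs with A′ ∋? s
        ... | no s∉A′ with E′.leaves r∈A′ s∉A′ rs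
        ...   | inj₂ zw   = inj₁ zw
        ...   | inj₁ refl with leaves r∈A c′∉A rs
        ...     | inj₁ c′≡c = contradiction c′≡c c′≢c
        ...     | inj₂ xy≡  = inj₂ xy≡
        exits {r} {s} (r∈A , r∈A′) s∉ rs | yes s∈A′
          with leaves r∈A (λ s∈A → s∉ (s∈A , s∈A′)) rs
        ...   | inj₁ refl = contradiction s∈A′ c∉A′
        ...   | inj₂ xy≡  = inj₂ xy≡

      -- `A′` misses the far side of `A`: with `c` deleted, an edge leaving their common part would
      -- be yx, or end at `c′` or `w`, and all three are excluded. So `A′` lies in `A` unless it
      -- contains `c`; in that case a neighbour of `c` on the far side gives an edge that `A′` does
      -- not allow.
      uncross-inside : ∀ {A′ z w c′} → End K A′ z w c′ → A ∋ z ⊎ z ≡ c → A ∋ w ⊎ w ≡ c →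
        A ∋ c′ ⊎ c′ ≡ c → ¬ A′ ∋ y → Smaller A
      uncross-inside {A′} {z} {w} {c′} e′ z∈ w∈ c′∈ y∉A′ = split c′∈
        where
        module E′ = End e′
        far-side-avoids : ∀ {v} → ¬ A ∋ v → v ≢ c → ¬ A′ ∋ v
        far-side-avoids {v} v∉A v≢c v∈A′
          with crossed c ((A opposite c) ∩ A′) {v} {y} (λ ((_ , c≢c) , _) → c≢c refl)
                 ((v∉A , v≢c) , v∈A′) (λ (_ , y∈A′) → y∉A′ y∈A′) y≢c
        ... | r , s , ((r∉A , r≢c) , r∈A′) , s∉ , s≢c , rs with A ∋? s
        ...   | yes s∈A with leaves s∈A r∉A (sym K rs)
        ...     | inj₁ r≡c        = r≢c r≡c
        ...     | inj₂ (_ , refl) = y∉A′ r∈A′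
        far-side-avoids {v} v∉A v≢c v∈A′
            | r , s , ((r∉A , r≢c) , r∈A′) , s∉ , s≢c , rs | no s∉A
          with E′.leaves r∈A′ (λ s∈A′ → s∉ ((s∉A , s≢c) , s∈A′)) rs
        ...     | inj₁ refl       = [ s∉A , s≢c ]′ c′∈
        ...     | inj₂ (_ , refl) = [ s∉A , s≢c ]′ w∈
        A′⊆A : ¬ A′ ∋ c → A′ ⊆ A
        A′⊆A c∉A′ {v} v∈A′ with A ∋? v
        ... | yes v∈A = v∈A
        ... | no  v∉A = contradiction v∈A′ (far-side-avoids v∉A λ { refl → c∉A′ v∈A′ })
        split : A ∋ c′ ⊎ c′ ≡ c → Smaller A
        split (inj₂ refl) = smaller e′ (A′⊆A E′.c∉A)
          ([ (λ w∈A → w∈A) , (λ w≡c → contradiction w≡c E′.y≢c) ]′ w∈) E′.y∉A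
        split (inj₁ c′∈A) with A′ ∋? c
        ... | no c∉A′ = smaller e′ (A′⊆A c∉A′) c′∈A E′.c∉A
        ... | yes c∈A′
          with crossed x (A opposite c) {y} {c} (λ (x∉A , _) → x∉A x∈A) (y∉A , y≢c)
                 (λ (_ , c≢c) → c≢c refl) (≢-sym x≢c)
        ...   | r , s , (r∉A , r≢c) , s∉ , s≢x , rs with End.leaves (flip-end e) (r∉A , r≢c) s∉ rs
        ...     | inj₂ (_ , s≡x) = contradiction s≡x s≢x
        ...     | inj₁ refl with E′.leaves c∈A′ (far-side-avoids r∉A r≢c) (sym K rs)
        ...       | inj₁ refl       = contradiction c′∈A r∉A
        ...       | inj₂ (_ , refl) = contradiction w∈ [ r∉A , r≢c ]′

    -- The end of zw is taken on the side avoiding `y` if its attachment vertex lies in A ∪ {c}, and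
    -- on the side avoiding `c` otherwise.
    uncross : ∀ {z w} → A ∋ z ⊎ z ≡ c → A ∋ w ⊎ w ≡ c → Adj K z w → Uncrossed (K -ₑ (z , w)) →
      Smaller A
    uncross z∈ w∈ zw un with ¬removable⇒end crossed zw un
    ... | A′ , c′ , e′ with (A ∋? c′) ⊎-dec (c′ ≟ c)
    ...   | yes c′∈ with A′ ∋? y
    ...     | no  y∉A′ = uncross-inside e′ z∈ w∈ c′∈ y∉A′
    ...     | yes y∈A′ = uncross-inside (flip-end e′) w∈ z∈ c′∈ (λ (y∉A′ , _) → y∉A′ y∈A′)
    uncross z∈ w∈ zw un | A′ , c′ , e′ | no c′∉ with A′ ∋? c
    ...     | no  c∉A′ = uncross-outside e′ z∈ w∈ (c′∉ ∘ inj₁) (c′∉ ∘ inj₂) c∉A′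
    ...     | yes c∈A′ = uncross-outside (flip-end e′) w∈ z∈ (c′∉ ∘ inj₁) (c′∉ ∘ inj₂)
                           (λ (c∉A′ , _) → c∉A′ c∈A′)

  record GoodEndIn (S : DSet n) : Set₁ where
    field
      {A}    : DSet n
      {x y c} : Fin n
      end    : End K A x y c
      inside : A ⊆ S
      inner  : InnerRemovable K A c

  uncrossed? : ∀ (K′ : Graph n) → Dec (Uncrossed K′)
  uncrossed? K′ = [ (λ cr → no (crossed⇒¬uncrossed cr)) , yes ]′ (crossed-or-not K′)

  good-or-smaller : ∀ {A x y c} → End K A x y c → GoodEndIn A ⊎ Smaller A
  good-or-smaller {A} {x} {y} {c} e
    with any? (λ z → any? (λ w → (A ∋? z ⊎-dec z ≟ c) ×-dec (A ∋? w ⊎-dec w ≟ c) ×-dec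
                adj? K z w ×-dec uncrossed? (K -ₑ (z , w))))
  ... | yes (z , w , z∈ , w∈ , zw , un) = inj₂ (uncross e z∈ w∈ zw un)
  ... | no  none = inj₁ record
    { end = e ; inside = λ v∈A → v∈A
    ; inner = λ {z} {w} z∈ w∈ zw → case crossed-or-not (K -ₑ (z , w)) of λ where
        (inj₁ cr) → cr
        (inj₂ un) → contradiction (z , w , z∈ , w∈ , zw , un) none }

  enlarge : ∀ {S T} → S ⊆ T → GoodEndIn S → GoodEndIn T
  enlarge S⊆T E = record { end = end ; inside = S⊆T ∘ inside ; inner = inner }
    where open GoodEndIn E

  good-end : ∀ {A x y c} → End K A x y c → GoodEndIn A
  good-end e = go _ e ≤-refl
    where
    go : ∀ m {A x y c} → End K A x y c → card A ≤ m → GoodEndIn A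
    go m e A≤m with good-or-smaller e
    ... | inj₁ good = good
    go zero e A≤m | inj₂ (_ , <A) = contradiction (≤-trans <A A≤m) λ ()
    go (suc m) e A≤m | inj₂ (E , <A) =
      enlarge (EndIn.inside E) (go m (EndIn.end E) (s≤s⁻¹ (≤-trans <A A≤m)))

  -- An attachment vertex of A′ inside A has to be x, and then y can be moved out of A′.
  retract : ∀ {A x y c A′ x′ y′ c′} → End K A x y c → End K A′ x′ y′ c′ →
    (∀ v → A ∋ v → ¬ A′ ∋ v) → ¬ A′ ∋ c → A ∋ c′ → Smaller A′
  retract {A} {x} {y} {c} {A′} {x′} {y′} {c′} e e′ disj c∉A′ c′∈A =
    let (y∈A′ , e″) = two-exits A′ E′.x∈A E′.y∉A E′.xy E′.c∉A (≢-sym E′.y≢c) exits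
    in smaller e″ proj₁ y∈A′ (λ (_ , y≢y) → y≢y refl)
    where
    module E′ = End e′
    exits : ∀ {r s} → A′ ∋ r → ¬ A′ ∋ s → Adj K r s → (r ≡ x′ × s ≡ y′) ⊎ (r ≡ y × s ≡ x)
    exits r∈A′ s∉A′ rs with E′.leaves r∈A′ s∉A′ rs
    ... | inj₂ xy≡  = inj₁ xy≡
    ... | inj₁ refl with End.leaves e c′∈A (λ r∈A → disj _ r∈A r∈A′) (sym K rs)
    ...   | inj₁ refl         = contradiction r∈A′ c∉A′
    ...   | inj₂ (c′≡x , r≡y) = inj₂ (r≡y , c′≡x)

  -- An end produced by `retract` need not be good any more, so shrinking and retracting alternate;
  -- the cardinality drops each time.
  good-end-avoiding : ∀ {A x y c A′ x′ y′ c′} → End K A x y c → End K A′ x′ y′ c′ →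
    (∀ v → A ∋ v → ¬ A′ ∋ v) → ¬ A′ ∋ c → Σ[ E ∈ GoodEndIn A′ ] ¬ A ∋ GoodEndIn.c E
  good-end-avoiding {A} {c = c} e e′ disj c∉ = go _ e′ disj c∉ ≤-refl
    where
    go : ∀ m {A′ x′ y′ c′} → End K A′ x′ y′ c′ → (∀ v → A ∋ v → ¬ A′ ∋ v) → ¬ A′ ∋ c →
      card A′ ≤ m → Σ[ E ∈ GoodEndIn A′ ] ¬ A ∋ GoodEndIn.c E
    next : ∀ m {A′} → Smaller A′ → (∀ v → A ∋ v → ¬ A′ ∋ v) → ¬ A′ ∋ c →
      card A′ ≤ m → Σ[ E ∈ GoodEndIn A′ ] ¬ A ∋ GoodEndIn.c E
    go m {A′} e′ disj c∉ A′≤m with good-or-smaller e′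
    ... | inj₂ sm = next m sm disj c∉ A′≤m
    ... | inj₁ E with A ∋? GoodEndIn.c E
    ...   | no  c′∉A = E , c′∉A
    ...   | yes c′∈A with retract e (GoodEndIn.end E) (λ v v∈A → disj v v∈A ∘ GoodEndIn.inside E)
                            (c∉ ∘ GoodEndIn.inside E) c′∈A
    ...     | E″ , <A″ = next m
      (record { end = EndIn.end E″ ; inside = GoodEndIn.inside E ∘ EndIn.inside E″ }
      , ≤-trans <A″ (card-⊆ (GoodEndIn.A E) A′ (GoodEndIn.inside E))) disj c∉ A′≤m
    next zero (_ , <A′) _ _ A′≤m = contradiction (≤-trans <A′ A′≤m) λ ()
    next (suc m) (E , <A′) disj c∉ A′≤m
      with go m (EndIn.end E) (λ v v∈A → disj v v∈A ∘ EndIn.inside E) (c∉ ∘ EndIn.inside E)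
             (s≤s⁻¹ (≤-trans <A′ A′≤m))
    ... | E″ , c″∉A = enlarge (EndIn.inside E) E″ , c″∉A

  -- With `c` deleted, a common part could be left only towards `w`. Such an edge starts at `s`
  -- because it leaves `A`, and at `s′` because it leaves `A′`.
  far-sides-disjoint : ∀ {A A′ s s′ w c} → End K A s w c → End K A′ s′ w c → s ≢ s′ →
    ∀ v → A ∋ v → ¬ A′ ∋ v
  far-sides-disjoint {A} {A′} {s} {s′} {w} {c} e e′ s≢s′ v v∈A v∈A′
    with crossed c (A ∩ A′) {v} {w} (λ (c∈A , _) → End.c∉A e c∈A) (v∈A , v∈A′)
           (λ (w∈A , _) → End.y∉A e w∈A) (End.y≢c e)
  ... | r , q , (r∈A , r∈A′) , q∉ , q≢c , rq with A ∋? q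
  ...   | no q∉A with End.leaves e r∈A q∉A rq
  ...     | inj₁ q≡c = q≢c q≡c
  ...     | inj₂ (refl , refl) with End.leaves e′ r∈A′ (End.y∉A e′) rq
  ...       | inj₁ w≡c = q≢c w≡c
  ...       | inj₂ (s≡s′ , _) = s≢s′ s≡s′
  far-sides-disjoint {A} {A′} {s} {s′} {w} {c} e e′ s≢s′ v v∈A v∈A′
    | r , q , (r∈A , r∈A′) , q∉ , q≢c , rq | yes q∈A
    with End.leaves e′ r∈A′ (λ q∈A′ → q∉ (q∈A , q∈A′)) rq
  ...     | inj₁ q≡c = q≢c q≡c
  ...     | inj₂ (_ , refl) = End.y∉A e q∈A

  -- This localises the deletability of bu to the end `A`. If `x` is outside `P`, then `P ∩ A` would
  -- be uncrossed once `c` and bu are deleted. If `x` is in `P` and `c` is in `P` or equals `t`, the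
  -- same holds for `A ∖ P`. Otherwise an edge from `P ∩ A` to `c` counts as a crossing too, so bu
  -- and xy are the only exits and `two-exits` yields an end for bu.
  second-crossing : ∀ {A x y c b u} → End K A x y c → A ∋ b → A ∋ u ⊎ u ≡ c → Adj K b u →
    Crossed (K -ₑ (b , u)) → ∀ t (P : DSet n) → ¬ A ∋ t → P ∋ b → ¬ P ∋ u → ¬ P ∋ t → u ≢ t →
    ¬ (∀ {r s} → P ∋ r → ¬ P ∋ s → s ≢ t → Adj K r s → A ∋ r ⊎ A ∋ s → r ≡ b × s ≡ u)
  second-crossing {A} {x} {y} {c} {b} {u} e b∈A u∈ bu cr t P t∉A b∈P u∉P t∉P u≢t only =
    split (P ∋? x) (P ∋? c ⊎-dec c ≟ t)
    where
    open End e
    ≢t : ∀ {v} → A ∋ v → v ≢ t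
    ≢t v∈A refl = t∉A v∈A
    split : Dec (P ∋ x) → Dec (P ∋ c ⊎ c ≡ t) → ⊥
    split (no x∉P) _
      with deleted-crossing {K = K} cr c (P ∩ A) {b} {x} (λ (_ , c∈A) → c∉A c∈A) (b∈P , b∈A)
             (λ (x∈P , _) → x∉P x∈P) x≢c
    ... | r , s , (r∈P , r∈A) , s∉ , s≢c , rs , ≢bu , _ with A ∋? s
    ...   | yes s∈A = ≢bu (only r∈P (λ s∈P → s∉ (s∈P , s∈A)) (≢t s∈A) rs (inj₁ r∈A))
    ...   | no s∉A with leaves r∈A s∉A rs
    ...     | inj₁ s≡c = s≢c s≡c
    ...     | inj₂ (refl , _) = x∉P r∈P
    split (yes x∈P) (yes c∈P⊎c≡t)
      with deleted-crossing {K = K} cr c (A ∖ P) {u} {b} (λ (c∈A , _) → c∉A c∈A) (u∈A , u∉P)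
             (λ (_ , b∉P) → b∉P b∈P) (λ { refl → c∉A b∈A })
      where
      u∈A : A ∋ u
      u∈A = [ (λ u∈A → u∈A) , (λ { refl → contradiction c∈P⊎c≡t [ u∉P , u≢t ]′ }) ]′ u∈
    ... | r , s , (r∈A , r∉P) , s∉ , s≢c , rs , _ , ≢ub with A ∋? s
    ...   | no s∉A with leaves r∈A s∉A rs
    ...     | inj₁ s≡c = s≢c s≡c
    ...     | inj₂ (refl , _) = r∉P x∈P
    split (yes x∈P) (yes c∈P⊎c≡t)
        | r , s , (r∈A , r∉P) , s∉ , s≢c , rs , _ , ≢ub | yes s∈A with P ∋? s
    ...     | no  s∉P = s∉ (s∈A , s∉P)
    ...     | yes s∈P with only s∈P r∉P (≢t r∈A) (sym K rs) (inj₁ s∈A)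
    ...       | s≡b , r≡u = ≢ub (r≡u , s≡b)
    split (yes x∈P) (no c∉) = end⇒¬removable (proj₂ (two-exits (P ∩ A) {q = t} (b∈P , b∈A)
        (λ (u∈P , _) → u∉P u∈P) bu (λ (t∈P , _) → t∉P t∈P) (≢-sym u≢t) exits)) cr
      where
      exits : ∀ {r s} → (P ∩ A) ∋ r → ¬ (P ∩ A) ∋ s → Adj K r s → (r ≡ b × s ≡ u) ⊎ (r ≡ x × s ≡ y)
      exits {r} {s} (r∈P , r∈A) s∉ rs with A ∋? s
      ... | yes s∈A = inj₁ (only r∈P (λ s∈P → s∉ (s∈P , s∈A)) (≢t s∈A) rs (inj₁ r∈A))
      ... | no s∉A with leaves r∈A s∉A rs
      ...   | inj₂ xy≡  = inj₂ xy≡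
      ...   | inj₁ refl = inj₁ (only r∈P (c∉ ∘ inj₁) (c∉ ∘ inj₂) rs (inj₁ r∈A))

-- Exchanging matching edges

crossed-mono : ∀ {K K′ : Graph n} → (∀ {r s} → Adj K r s → Adj K′ r s) → Crossed K → Crossed K′
crossed-mono K⊆K′ cr t P t∉P p∈P q∉P q≢t with cr t P t∉P p∈P q∉P q≢t
... | r , s , r∈P , s∉P , s≢t , rs = r , s , r∈P , s∉P , s≢t , K⊆K′ rs

disjoint-sym : ∀ {e f : Fin n × Fin n} → Disjoint e f → Disjoint f e
disjoint-sym (ux , uy , wx , wy) = ≢-sym ux , ≢-sym wx , ≢-sym uy , ≢-sym wy

record Extraction (G : Graph n) (e : Fin n × Fin n) (M : EdgeList n) : Set where
  field
    rest     : EdgeList n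
    matching : Matching G rest
    apart    : All (Disjoint e) rest
    rest⊆    : ∀ {f} → f ∈ rest → f ∈ M
    size     : length M ≡ suc (length rest)

extract : ∀ {G : Graph n} {e M} → Matching G M → e ∈ M → Extraction G e M
extract {M = e ∷ M} mat (here refl) = record
  { rest = M ; matching = record { edges = All.tail edges ; disjoint = AllPairs-tail disjoint }
  ; apart = AllPairs-head disjoint ; rest⊆ = there ; size = refl }
  where
  open Matching mat
  AllPairs-tail : AllPairs Disjoint (e ∷ M) → AllPairs Disjoint M
  AllPairs-tail (_ ∷ ps) = ps
  AllPairs-head : AllPairs Disjoint (e ∷ M) → All (Disjoint e) M
  AllPairs-head (p ∷ _) = p
extract {G = G} {M = f ∷ M} record { edges = fe ∷ edges ; disjoint = f# ∷ disjoint } (there e∈M)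
  with extract {G = G} (record { edges = edges ; disjoint = disjoint }) e∈M
... | ex = record
  { rest = f ∷ rest
  ; matching = record { edges = fe ∷ Matching.edges matching
                      ; disjoint = All.tabulate (All.lookup f# ∘ rest⊆) ∷ Matching.disjoint matching }
  ; apart = disjoint-sym (All.lookup f# e∈M) ∷ apart
  ; rest⊆ = λ { (here refl) → here refl ; (there g∈) → there (rest⊆ g∈) }
  ; size = cong suc size }
  where open Extraction ex

Mate : EdgeList n → Fin n → Fin n → Set
Mate M a b = (a , b) ∈ M ⊎ (b , a) ∈ M

covered-mate : ∀ {M : EdgeList n} {a b} → Mate M a b → Covered M a
covered-mate (inj₁ ab∈M) = Any.map (λ { refl → inj₁ refl }) ab∈M
covered-mate (inj₂ ba∈M) = Any.map (λ { refl → inj₂ refl }) ba∈M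

mate-unique : ∀ {M : EdgeList n} {v a b} → AllPairs Disjoint M → Mate M v a → Mate M v b → a ≡ b
mate-unique {M = []} _ (inj₁ ()) _
mate-unique {M = []} _ (inj₂ ()) _
mate-unique {M = e ∷ M} {v} {a} {b} (e# ∷ M#) ma mb = combine (first ma) (first mb)
  where
  Is : Fin _ → Set
  Is w = (v , w) ≡ e ⊎ (w , v) ≡ e
  first : ∀ {w} → Mate (e ∷ M) v w → Is w ⊎ Mate M v w
  first (inj₁ (here eq))  = inj₁ (inj₁ eq)
  first (inj₂ (here eq))  = inj₁ (inj₂ eq)
  first (inj₁ (there ∈M)) = inj₂ (inj₁ ∈M)
  first (inj₂ (there ∈M)) = inj₂ (inj₂ ∈M)
  both : Is a → Is b → a ≡ b
  both (inj₁ refl) (inj₁ refl) = refl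
  both (inj₁ refl) (inj₂ refl) = refl
  both (inj₂ refl) (inj₁ refl) = refl
  both (inj₂ refl) (inj₂ refl) = refl
  apart : ∀ {w w′} → Is w → Mate M v w′ → ⊥
  apart (inj₁ refl) (inj₁ ∈M) = proj₁ (All.lookup e# ∈M) refl
  apart (inj₁ refl) (inj₂ ∈M) = proj₁ (proj₂ (All.lookup e# ∈M)) refl
  apart (inj₂ refl) (inj₁ ∈M) = proj₁ (proj₂ (proj₂ (All.lookup e# ∈M))) refl
  apart (inj₂ refl) (inj₂ ∈M) = proj₂ (proj₂ (proj₂ (All.lookup e# ∈M))) refl
  combine : Is a ⊎ Mate M v a → Is b ⊎ Mate M v b → a ≡ b
  combine (inj₁ p) (inj₁ q) = both p q
  combine (inj₁ p) (inj₂ q) = ⊥-elim (apart p q)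
  combine (inj₂ p) (inj₁ q) = ⊥-elim (apart q p)
  combine (inj₂ p) (inj₂ q) = mate-unique M# p q

-- In the applications `p` and `q` count the covered vertices of two disjoint ends, and `m` is 2,
-- from |M| < d, plus the number of further covered vertices known outside both.
squeeze : ∀ {d p q} m i j → m + (p + q) ≤ d + d → d ≤ i + p → d ≤ j + q → i + j < m → ⊥
squeeze {d} {p} {q} m i j m≤ d≤i d≤j i+j<m = <-irrefl refl (begin-strict
  d + d               ≤⟨ +-mono-≤ d≤i d≤j ⟩
  (i + p) + (j + q)   ≡⟨ interchange i p j q ⟩
  (i + j) + (p + q)   <⟨ +-monoˡ-≤ (p + q) i+j<m ⟩
  m + (p + q)         ≤⟨ m≤ ⟩
  d + d               ∎)
  where
  open ≤-Reasoning
  interchange : ∀ i p j q → (i + p) + (j + q) ≡ (i + j) + (p + q)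
  interchange = solve-∀

-- A matching that cannot be enlarged, and its exchanges

module Augment {n : ℕ} (G : Graph n) (d : ℕ) (5≤d : 5 ≤ d) (degrees : ∀ v → d ≤ card (N G v))
  (2d≤n : d + d ≤ n) (M : EdgeList n) (short : length M < d) (mat : Matching G M)
  (crossed : Crossed (G -ᴱ M))
  (stuck : ∀ M′ → Matching G M′ → length M′ ≡ suc (length M) → ¬ Crossed (G -ᴱ M′)) where

  private
    H : Graph n
    H = G -ᴱ M

    open DecMembership (≡-dec (_≟_ {n}) (_≟_ {n})) using (_∈?_)

    mate? : ∀ a b → Dec (Mate M a b)
    mate? a b = ((a , b) ∈? M) ⊎-dec ((b , a) ∈? M)

  VM : DSet n
  VM = record { _∋_ = Covered M ; _∋?_ = λ v → Any.any? (λ (a , b) → (v ≟ a) ⊎-dec (v ≟ b)) M }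

  Free : Fin n → Set
  Free v = ¬ VM ∋ v

  covered : ∀ {a b} → Mate M a b → VM ∋ a
  covered = covered-mate

  kept : ∀ {v w} → ¬ Mate M v w → Adj G v w → Adj H v w
  kept ¬mate vw = vw , ¬mate ∘ inj₁ , ¬mate ∘ inj₂

  kept-free : ∀ {v w} → Free v → Adj G v w → Adj H v w
  kept-free v∉ = kept (v∉ ∘ covered)

  not-mates : ∀ {v w} → Adj H v w → ¬ Mate M v w
  not-mates (_ , ∉₁ , ∉₂) = [ ∉₁ , ∉₂ ]′

  degreeH : ∀ v → d ≤ suc (card (N H v))
  degreeH v with any? (mate? v)
  ... | yes (w , vw) = ≤-trans (degrees v) (card≤suc (N G v) (N H v) w λ u vu u≢w →
          kept (λ mate → u≢w (mate-unique (Matching.disjoint mat) mate vw)) vu)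
  ... | no  none     = ≤-trans (degrees v) (≤-trans
          (card-⊆ (N G v) (N H v) (λ {u} → kept (λ mate → none (u , mate)))) (n≤1+n _))

  -- Deleting a matching costs each vertex at most one neighbour, so degrees in `H` are at least d -
  -- 1 ≥ 4.
  fourth-neighbour : ∀ v a b c → ∃ λ m → Adj H v m × m ≢ a × m ≢ b × m ≢ c
  fourth-neighbour v a b c with card-pick (N H v) (⁅ a ⁆ ∪ ⁅ b ⁆ ∪ ⁅ c ⁆) (begin-strict
    card (⁅ a ⁆ ∪ ⁅ b ⁆ ∪ ⁅ c ⁆)              ≤⟨ card-cover (⁅ a ⁆ ∪ ⁅ b ⁆ ∪ ⁅ c ⁆) (⁅ a ⁆ ∪ ⁅ b ⁆) ⁅ c ⁆ (λ _ v∈ → v∈) ⟩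
    card (⁅ a ⁆ ∪ ⁅ b ⁆) + card ⁅ c ⁆         ≤⟨ +-monoˡ-≤ (card ⁅ c ⁆) (card-cover (⁅ a ⁆ ∪ ⁅ b ⁆) ⁅ a ⁆ ⁅ b ⁆ (λ _ v∈ → v∈)) ⟩
    card ⁅ a ⁆ + card ⁅ b ⁆ + card ⁅ c ⁆      ≡⟨ threes ⟩
    3                                         <⟨ s≤s⁻¹ (≤-trans 5≤d (degreeH v)) ⟩
    card (N H v)                              ∎)
    where
    open ≤-Reasoning
    threes : card ⁅ a ⁆ + card ⁅ b ⁆ + card ⁅ c ⁆ ≡ 3
    threes rewrite card-⁅⁆ a | card-⁅⁆ b | card-⁅⁆ c = refl
  ... | m , vm , m∉ = m , vm , (λ { refl → m∉ (inj₁ (inj₁ refl)) })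
                             , (λ { refl → m∉ (inj₁ (inj₂ refl)) }) , (λ { refl → m∉ (inj₂ refl) })

  third-neighbour : ∀ v a b → ∃ λ m → Adj H v m × m ≢ a × m ≢ b
  third-neighbour v a b = let (m , vm , m≢a , m≢b , _) = fourth-neighbour v a b b in m , vm , m≢a , m≢b

  open Ends H crossed third-neighbour

  2∣M∣≤ : suc (suc (length M + length M)) ≤ d + d
  2∣M∣≤ = ≤-trans (≤-reflexive (cong suc (≡-sym (+-suc (length M) _)))) (+-mono-≤ short short)

  card-VM : 2 + card VM ≤ d + d
  card-VM = ≤-trans (s≤s (s≤s (≤-trans (sum≤weight (ind VM) M covers) (weight≤2 (ind VM) (ind≤1 VM) M)))) 2∣M∣≤
    where
    covers : ∀ v → ind VM v ≡ 0 ⊎ Covered M v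
    covers v with VM ∋? v
    ... | yes v∈ = inj₂ v∈
    ... | no  _  = inj₁ refl

  add-edge : ∀ {u v} → Free u → Free v → Adj G u v → ¬ Crossed (H -ₑ (u , v))
  add-edge {u} {v} u∉ v∉ uv cr = stuck ((u , v) ∷ M)
    record { edges = uv ∷ Matching.edges mat ; disjoint = All.tabulate apart ∷ Matching.disjoint mat }
    refl
    (crossed-mono {K = H -ₑ (u , v)} {K′ = G -ᴱ ((u , v) ∷ M)}
      (λ ((rs , rs∉ , sr∉) , rs∉′ , sr∉′) → rs
        , (λ { (here eq) → rs∉′ (here eq) ; (there ∈M) → rs∉ ∈M })
        , (λ { (here eq) → sr∉′ (here eq) ; (there ∈M) → sr∉ ∈M }))
      cr)
    where
    apart : ∀ {e} → e ∈ M → Disjoint (u , v) e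
    apart e∈M = (λ { refl → u∉ (covered (inj₁ e∈M)) }) , (λ { refl → u∉ (covered (inj₂ e∈M)) })
              , (λ { refl → v∉ (covered (inj₁ e∈M)) }) , (λ { refl → v∉ (covered (inj₂ e∈M)) })

  -- The sets P over which the exchange of ab for au and bv could fail.
  record Blocked (a b u v : Fin n) : Set₁ where
    field
      t   : Fin n
      P   : DSet n
      a∈P : P ∋ a
      b∈P : P ∋ b
      u∉P : ¬ P ∋ u
      v∉P : ¬ P ∋ v
      t∉P : ¬ P ∋ t
      u≢t : u ≢ t
      v≢t : v ≢ t
      only : ∀ {r s} → P ∋ r → ¬ P ∋ s → s ≢ t → Adj H r s → (r ≡ a × s ≡ u) ⊎ (r ≡ b × s ≡ v)

  -- The new graph lacks only au and bv from `H`. As `H` remains crossed without au, an uncrossed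
  -- `P` must be crossed by bv, and likewise by au. The restored edge ab does not cross, so `a` and
  -- `b` are on the same side; if that is the outside, the complement of `P` without `t` is used.
  exchange : ∀ {a b u v} → (a , b) ∈ M → u ≢ v → Free u → Free v → Adj G u a → Adj G v b →
    Crossed (H -ₑ (a , u)) → Crossed (H -ₑ (b , v)) → Blocked a b u v
  exchange {a} {b} {u} {v} ab∈M u≢v u∉ v∉ ua vb cra crb
    with crossed-or-not (G -ᴱ ((u , a) ∷ (v , b) ∷ Extraction.rest (extract mat ab∈M)))
  ... | inj₁ cr = contradiction cr (stuck _
    record
      { edges = ua ∷ vb ∷ Matching.edges matching
      ; disjoint = ((u≢v , ≢-covered u∉ b∈ , ≢-sym (≢-covered v∉ a∈) , a≢b)
                     ∷ All.tabulate (λ e∈ → apart₁ e∈ (All.lookup apart e∈)))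
                 ∷ All.tabulate (λ e∈ → apart₂ e∈ (All.lookup apart e∈)) ∷ Matching.disjoint matching }
    (cong suc (≡-sym size)))
    where
    open Extraction (extract mat ab∈M)
    ≢-covered : ∀ {z w} → Free z → VM ∋ w → z ≢ w
    ≢-covered z∉ w∈ refl = z∉ w∈
    a∈ : VM ∋ a
    a∈ = covered (inj₁ ab∈M)
    b∈ : VM ∋ b
    b∈ = covered (inj₂ ab∈M)
    a≢b : a ≢ b
    a≢b refl = irrefl G (All.lookup (Matching.edges mat) ab∈M)
    apart₁ : ∀ {e} → e ∈ rest → Disjoint (a , b) e → Disjoint (u , a) e
    apart₁ e∈ (ax , ay , _) = ≢-covered u∉ (covered (inj₁ (rest⊆ e∈))) , ≢-covered u∉ (covered (inj₂ (rest⊆ e∈))) , ax , ay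
    apart₂ : ∀ {e} → e ∈ rest → Disjoint (a , b) e → Disjoint (v , b) e
    apart₂ e∈ (_ , _ , bx , by) = ≢-covered v∉ (covered (inj₁ (rest⊆ e∈))) , ≢-covered v∉ (covered (inj₂ (rest⊆ e∈))) , bx , by
  ... | inj₂ un = orient (deleted-crossing {K = H} cra t P t∉P p∈P q∉P q≢t)
                         (deleted-crossing {K = H} crb t P t∉P p∈P q∉P q≢t)
    where
    open Uncrossed un
    open Extraction (extract mat ab∈M) using (rest; rest⊆; apart)
    IsA IsB : Fin n → Fin n → Set
    IsA r s = (r ≡ a × s ≡ u) ⊎ (r ≡ u × s ≡ a)
    IsB r s = (r ≡ b × s ≡ v) ⊎ (r ≡ v × s ≡ b)

    only : ∀ {r s} → P ∋ r → ¬ P ∋ s → s ≢ t → Adj H r s → IsA r s ⊎ IsB r s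
    only {r} {s} r∈ s∉ s≢t (rs , rs∉ , sr∉)
      with ((r ≟ a ×-dec s ≟ u) ⊎-dec (r ≟ u ×-dec s ≟ a)) | ((r ≟ b ×-dec s ≟ v) ⊎-dec (r ≟ v ×-dec s ≟ b))
    ... | yes isA | _       = inj₁ isA
    ... | _       | yes isB = inj₂ isB
    ... | no ¬a   | no ¬b   = contradiction (rs , new , new′) (no-edge r∈ s∉ s≢t)
      where
      new : (r , s) ∉ (u , a) ∷ (v , b) ∷ rest
      new (here refl)         = ¬a (inj₂ (refl , refl))
      new (there (here refl)) = ¬b (inj₂ (refl , refl))
      new (there (there ∈r))  = rs∉ (rest⊆ ∈r)
      new′ : (s , r) ∉ (u , a) ∷ (v , b) ∷ rest
      new′ (here refl)         = ¬a (inj₁ (refl , refl))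
      new′ (there (here refl)) = ¬b (inj₁ (refl , refl))
      new′ (there (there ∈r))  = sr∉ (rest⊆ ∈r)

    ab-kept : Adj (G -ᴱ ((u , a) ∷ (v , b) ∷ rest)) a b
    ab-kept = All.lookup (Matching.edges mat) ab∈M , ab∉ , ba∉
      where
      ab∉ : (a , b) ∉ (u , a) ∷ (v , b) ∷ rest
      ab∉ (here refl)         = u∉ (covered (inj₁ ab∈M))
      ab∉ (there (here refl)) = v∉ (covered (inj₁ ab∈M))
      ab∉ (there (there ∈r))  = proj₁ (All.lookup apart ∈r) refl
      ba∉ : (b , a) ∉ (u , a) ∷ (v , b) ∷ rest
      ba∉ (here refl)         = u∉ (covered (inj₂ ab∈M))
      ba∉ (there (here refl)) = v∉ (covered (inj₂ ab∈M))
      ba∉ (there (there ∈r))  = proj₁ (proj₂ (All.lookup apart ∈r)) refl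

    Crossing : (Fin n → Fin n → Set) → Set
    Crossing Q = ∃₂ λ r s → P ∋ r × ¬ P ∋ s × s ≢ t × Adj H r s × Q r s

    split : (∃₂ λ r s → P ∋ r × ¬ P ∋ s × s ≢ t × Adj H r s × ¬ (r ≡ a × s ≡ u) × ¬ (r ≡ u × s ≡ a)) →
            (∃₂ λ r s → P ∋ r × ¬ P ∋ s × s ≢ t × Adj H r s × ¬ (r ≡ b × s ≡ v) × ¬ (r ≡ v × s ≡ b)) →
            Crossing IsB × Crossing IsA
    split (r , s , r∈ , s∉ , s≢ , rs , ¬1 , ¬2) (r′ , s′ , r′∈ , s′∉ , s′≢ , rs′ , ¬1′ , ¬2′) =
      (r , s , r∈ , s∉ , s≢ , rs , [ (λ isA → contradiction isA [ ¬1 , ¬2 ]′) , (λ isB → isB) ]′ (only r∈ s∉ s≢ rs)) ,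
      (r′ , s′ , r′∈ , s′∉ , s′≢ , rs′ , [ (λ isA → isA) , (λ isB → contradiction isB [ ¬1′ , ¬2′ ]′) ]′ (only r′∈ s′∉ s′≢ rs′))

    build : Crossing IsB × Crossing IsA → Blocked a b u v
    build ((_ , _ , b∈ , v∉P , v≢t , _ , inj₁ (refl , refl)) , (_ , _ , a∈ , u∉P , u≢t , _ , inj₁ (refl , refl))) = record
      { t = t ; P = P ; a∈P = a∈ ; b∈P = b∈ ; u∉P = u∉P ; v∉P = v∉P ; t∉P = t∉P ; u≢t = u≢t ; v≢t = v≢t
      ; only = λ r∈ s∉ s≢t rs → case only r∈ s∉ s≢t rs of λ where
          (inj₁ (inj₁ au))         → inj₁ au
          (inj₁ (inj₂ (refl , _))) → contradiction r∈ u∉P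
          (inj₂ (inj₁ bv))         → inj₂ bv
          (inj₂ (inj₂ (refl , _))) → contradiction r∈ v∉P }
    build ((_ , _ , b∈ , _ , _ , _ , inj₁ (refl , refl)) , (_ , _ , _ , a∉ , a≢t , _ , inj₂ (refl , refl))) =
      contradiction (sym (G -ᴱ ((u , a) ∷ (v , b) ∷ rest)) ab-kept) (no-edge b∈ a∉ a≢t)
    build ((_ , _ , _ , b∉ , b≢t , _ , inj₂ (refl , refl)) , (_ , _ , a∈ , _ , _ , _ , inj₁ (refl , refl))) =
      contradiction ab-kept (no-edge a∈ b∉ b≢t)
    build ((_ , _ , v∈ , b∉ , b≢t , _ , inj₂ (refl , refl)) , (_ , _ , u∈ , a∉ , a≢t , _ , inj₂ (refl , refl))) = record
      { t = t ; P = P opposite t ; a∈P = a∉ , a≢t ; b∈P = b∉ , b≢t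
      ; u∉P = λ (u∉P , _) → u∉P u∈ ; v∉P = λ (v∉P , _) → v∉P v∈ ; t∉P = λ (_ , t≢t) → t≢t refl
      ; u≢t = λ { refl → t∉P u∈ } ; v≢t = λ { refl → t∉P v∈ }
      ; only = only′ }
      where
      only′ : ∀ {r s} → ¬ P ∋ r × r ≢ t → ¬ (¬ P ∋ s × s ≢ t) → s ≢ t → Adj H r s →
        (r ≡ a × s ≡ u) ⊎ (r ≡ b × s ≡ v)
      only′ {r} {s} (r∉ , r≢t) s∉ s≢t rs with P ∋? s
      ... | no  s∉P = contradiction (s∉P , s≢t) s∉
      ... | yes s∈P with only s∈P r∉ r≢t (sym H rs)
      ...   | inj₁ (inj₁ (refl , _)) = contradiction s∈P a∉
      ...   | inj₁ (inj₂ (su , ra))  = inj₁ (ra , su)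
      ...   | inj₂ (inj₁ (refl , _)) = contradiction s∈P b∉
      ...   | inj₂ (inj₂ (sv , rb))  = inj₂ (rb , sv)

    orient = λ withoutA withoutB → build (split withoutA withoutB)

  exchange-mates : ∀ {a b u v} → Mate M a b → u ≢ v → Free u → Free v → Adj G u a → Adj G v b →
    Crossed (H -ₑ (a , u)) → Crossed (H -ₑ (b , v)) → Blocked a b u v
  exchange-mates (inj₁ ab) = exchange ab
  exchange-mates (inj₂ ba) u≢v u∉ v∉ ua vb cra crb = record
    { t = t ; P = P ; a∈P = b∈P ; b∈P = a∈P ; u∉P = v∉P ; v∉P = u∉P ; t∉P = t∉P ; u≢t = v≢t ; v≢t = u≢t
    ; only = λ r∈ s∉ s≢t rs → swap (only r∈ s∉ s≢t rs) }
    where open Blocked (exchange ba (≢-sym u≢v) v∉ u∉ vb ua crb cra)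

  mates-distinct : ∀ {a b} → Mate M a b → a ≢ b
  mates-distinct (inj₁ ab) refl = irrefl G (All.lookup (Matching.edges mat) ab)
  mates-distinct (inj₂ ba) refl = irrefl G (All.lookup (Matching.edges mat) ba)

  -- The edge bu of `H` crosses every blocking set, but it is neither au nor bv.
  exchange-triangle : ∀ {a b u v} → Mate M a b → u ≢ v → Free u → Free v →
    Adj G u a → Adj G u b → Adj G v b → Crossed (H -ₑ (a , u)) → Crossed (H -ₑ (b , v)) → ⊥
  exchange-triangle mate u≢v u∉ v∉ ua ub vb cra crb
    with exchange-mates mate u≢v u∉ v∉ ua vb cra crb
  ... | bl with Blocked.only bl (Blocked.b∈P bl) (Blocked.u∉P bl) (Blocked.u≢t bl) (sym H (kept-free u∉ ub))
  ...   | inj₁ (b≡a , _) = mates-distinct mate (≡-sym b≡a)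
  ...   | inj₂ (_ , u≡v) = u≢v u≡v

  -- The deleted vertex `t` misses one of the two disjoint ends. The exchanged edge of the other end
  -- does not touch that one, so its own exchanged edge would be the only crossing near it, against
  -- `second-crossing`.
  exchange-ends : ∀ {A x y c A′ x′ y′ c′ a b u v} → End H A x y c → End H A′ x′ y′ c′ →
    (∀ v → A ∋ v → ¬ A′ ∋ v) → ¬ A′ ∋ c → ¬ A ∋ c′ →
    A ∋ a → A ∋ u ⊎ u ≡ c → A′ ∋ b → A′ ∋ v ⊎ v ≡ c′ →
    Mate M a b → u ≢ v → Free u → Free v → Adj G u a → Adj G v b →
    Crossed (H -ₑ (a , u)) → Crossed (H -ₑ (b , v)) → ⊥
  exchange-ends {A} {A′ = A′} {a = a} {b} {u} {v} e e′ disj c∉A′ c′∉A a∈A u∈ b∈A′ v∈ mate u≢v u∉ v∉ ua vb cra crb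
    with exchange-mates mate u≢v u∉ v∉ ua vb cra crb
  ... | bl with A ∋? Blocked.t bl
  ...   | no t∉A = second-crossing e a∈A u∈ (sym H (kept-free u∉ ua)) cra t P t∉A a∈P u∉P t∉P u≢t
          λ r∈ s∉ s≢t rs near → case only r∈ s∉ s≢t rs of λ where
            (inj₁ au) → au
            (inj₂ (refl , refl)) → ⊥-elim (far near)
    where
    open Blocked bl
    far : ¬ (A ∋ b ⊎ A ∋ v)
    far (inj₁ b∈A) = disj b b∈A b∈A′
    far (inj₂ v∈A) = [ disj v v∈A , (λ { refl → c′∉A v∈A }) ]′ v∈
  ...   | yes t∈A = second-crossing e′ b∈A′ v∈ (sym H (kept-free v∉ vb)) crb t P (disj t t∈A) b∈P v∉P t∉P v≢t
          λ r∈ s∉ s≢t rs near → case only r∈ s∉ s≢t rs of λ where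
            (inj₂ bv) → bv
            (inj₁ (refl , refl)) → ⊥-elim (far near)
    where
    open Blocked bl
    far : ¬ (A′ ∋ a ⊎ A′ ∋ u)
    far (inj₁ a∈A′) = disj a a∈A a∈A′
    far (inj₂ u∈A′) = [ (λ u∈A → disj u u∈A u∈A′) , (λ { refl → c∉A′ u∈A′ }) ]′ u∈

  -- Counting around an end

  -- A free vertex u from which an exchange can enter A.
  record HasHandle (A : DSet n) (c : Fin n) : Set where
    field
      u      : Fin n
      u-free : Free u
      u∈     : A ∋ u ⊎ (u ≡ c × card A < d × A ⊆ VM)
      many   : d ≤ 2 + card (N G u ∩ (A ∩ VM))

    u∈D : A ∋ u ⊎ u ≡ c
    u∈D = [ inj₁ , inj₂ ∘ proj₁ ]′ u∈

  module GoodEnd {A x y c} (e : End H A x y c) (inner : InnerRemovable H A c) where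
    open End e

    independent : ∀ {u v} → A ∋ u ⊎ u ≡ c → A ∋ v ⊎ v ≡ c → Free u → Free v → ¬ Adj G u v
    independent u∈ v∈ u-free v-free uv = add-edge u-free v-free uv (inner u∈ v∈ (kept-free u-free uv))

    neighbour : ∀ {z w} → A ∋ z → Adj H z w → A ∋ w ⊎ w ≡ c ⊎ w ≡ y
    neighbour {w = w} z∈A zw with A ∋? w
    ... | yes w∈A = inj₁ w∈A
    ... | no  w∉A = inj₂ ([ inj₁ , inj₂ ∘ proj₂ ]′ (leaves z∈A w∉A zw))

    inner-neighbour : ∀ {z w} → A ∋ z → z ≢ x → Adj H z w → A ∋ w ⊎ w ≡ c
    inner-neighbour {w = w} z∈A z≢x zw with A ∋? w
    ... | yes w∈A = inj₁ w∈A
    ... | no  w∉A = inj₂ ([ (λ w≡c → w≡c) , (λ (z≡x , _) → contradiction z≡x z≢x) ]′ (leaves z∈A w∉A zw))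

    -- Vertices of `A` other than `x` see only A ∪ {c}, which makes them the ones to count with. One
    -- exists among the four neighbours of `x`, even with `t` excluded.
    inner-vertex : ∀ t → ∃ λ z → A ∋ z × z ≢ x × z ≢ t
    inner-vertex t with fourth-neighbour x c y t
    ... | z , xz , z≢c , z≢y , z≢t with neighbour x∈A xz
    ...   | inj₁ z∈A        = z , z∈A , (λ { refl → irrefl H xz }) , z≢t
    ...   | inj₂ (inj₁ z≡c) = contradiction z≡c z≢c
    ...   | inj₂ (inj₂ z≡y) = contradiction z≡y z≢y

    shrink : ∀ {z} → A ∋ z → suc (card (A - z)) ≤ card A
    shrink {z} z∈A = card-strict (A - z) A z proj₁ z∈A (λ (_ , z≢z) → z≢z refl)

    inner-degree : ∀ {z} → A ∋ z → z ≢ x → card (N H z) ≤ card A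
    inner-degree {z} z∈A z≢x = ≤-trans (card≤suc (N H z) (A - z) c sub) (shrink z∈A)
      where
      sub : ∀ w → Adj H z w → w ≢ c → (A - z) ∋ w
      sub w zw w≢c = [ (λ w∈A → w∈A) , (λ w≡c → contradiction w≡c w≢c) ]′ (inner-neighbour z∈A z≢x zw)
                   , (λ { refl → irrefl H zw })

    -- An inner vertex `z` has at least d - 1 neighbours in `H`, all of them in `A - z` or equal to
    -- `c`.
    large : d ≤ suc (card A)
    large = let (z , z∈A , z≢x , _) = inner-vertex x in
      ≤-trans (degreeH z) (s≤s (inner-degree z∈A z≢x))

    free-inner-∪c : ∀ {z} → A ∋ z → z ≢ x → Free z → ∀ w → Adj G z w → (A ∋ w ⊎ w ≡ c) × VM ∋ w
    free-inner-∪c {z} z∈A z≢x z-free w zw = w∈ , decidable-stable (VM ∋? w)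
      (λ w-free → independent (inj₁ z∈A) w∈ z-free w-free zw)
      where
      w∈ : A ∋ w ⊎ w ≡ c
      w∈ = inner-neighbour z∈A z≢x (kept-free z-free zw)

    free-inner : ∀ {z} → A ∋ z → z ≢ x → Free z → d ≤ 1 + card (A ∩ VM)
    free-inner {z} z∈A z≢x z-free = ≤-trans (degrees z) (card≤suc (N G z) (A ∩ VM) c λ w zw w≢c →
      let (w∈ , w∈VM) = free-inner-∪c z∈A z≢x z-free w zw in
      [ (λ w∈A → w∈A) , (λ w≡c → contradiction w≡c w≢c) ]′ w∈ , w∈VM)

    free-inner-c : ∀ {z} → A ∋ z → z ≢ x → Free z → Free c → d ≤ card (A ∩ VM)
    free-inner-c {z} z∈A z≢x z-free c-free = ≤-trans (degrees z) (card-⊆ (N G z) (A ∩ VM) λ {w} zw →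
      let (w∈ , w∈VM) = free-inner-∪c z∈A z≢x z-free w zw in
      [ (λ w∈A → w∈A) , (λ { refl → contradiction w∈VM c-free }) ]′ w∈ , w∈VM)

    free-many : ∀ {u} → A ∋ u → Free u → d ≤ 2 + card (N G u ∩ (A ∩ VM))
    free-many {u} u∈A u-free = ≤-trans (degrees u) (card≤suc² (N G u) (N G u ∩ (A ∩ VM)) c y sub)
      where
      sub : ∀ w → Adj G u w → w ≢ c → w ≢ y → (N G u ∩ (A ∩ VM)) ∋ w
      sub w uw w≢c w≢y with neighbour u∈A (kept-free u-free uw)
      ... | inj₂ (inj₁ w≡c) = contradiction w≡c w≢c
      ... | inj₂ (inj₂ w≡y) = contradiction w≡y w≢y
      ... | inj₁ w∈A = uw , w∈A , decidable-stable (VM ∋? w)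
              (λ w-free → independent (inj₁ u∈A) (inj₁ w∈A) u-free w-free uw)

    all-covered : A ⊆ VM → d ≤ 1 + card (A ∩ VM)
    all-covered A⊆VM = ≤-trans large (s≤s (card-⊆ A (A ∩ VM) (λ v∈A → v∈A , A⊆VM v∈A)))

    free-or-covered : (∃ λ u → A ∋ u × Free u) ⊎ A ⊆ VM
    free-or-covered with any? (λ u → A ∋? u ×-dec ¬? (VM ∋? u))
    ... | yes found = inj₁ found
    ... | no  none  = inj₂ λ {v} v∈A → decidable-stable (VM ∋? v) λ v-free → none (v , v∈A , v-free)

    covered-bound : d ≤ 2 + card (A ∩ VM)
    covered-bound with free-or-covered
    ... | inj₁ (u , u∈A , u-free) = ≤-trans (free-many u∈A u-free)
            (s≤s (s≤s (card-⊆ (N G u ∩ (A ∩ VM)) (A ∩ VM) proj₂)))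
    ... | inj₂ A⊆VM = ≤-trans (all-covered A⊆VM) (n≤1+n _)

    -- In a small end, `z` has at least as many neighbours in `H` as there are vertices of A ∪ {c}
    -- other than `z`, and no neighbours elsewhere; so it misses none.
    clique : card A < d → ∀ {z w} → A ∋ z → z ≢ x → A ∋ w ⊎ w ≡ c → w ≢ z → Adj H z w
    clique A<d {z} {w} z∈A z≢x w∈ w≢z =
      card-tight (N H z) D sub (≤-trans D≤A (s≤s⁻¹ (≤-trans A<d (degreeH z)))) (w∈ , w≢z)
      where
      D : DSet n
      D = (A ∪ ⁅ c ⁆) - z
      sub : N H z ⊆ D
      sub zw = inner-neighbour z∈A z≢x zw , (λ { refl → irrefl H zw })
      D≤A : card D ≤ card A
      D≤A = ≤-trans (card≤suc D (A - z) c
        (λ v (v∈ , v≢z) v≢c → [ (λ v∈A → v∈A) , (λ v≡c → contradiction v≡c v≢c) ]′ v∈ , v≢z)) (shrink z∈A)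

    -- One of the mates differs from `x`, so in a small end they would be adjacent in `H`, from
    -- which their edge was deleted.
    mates-inside : ∀ {a b} → A ∋ a → A ∋ b → Mate M a b → d ≤ card A
    mates-inside {a} {b} a∈A b∈A ab = ≮⇒≥ λ A<d → not-clique A<d (a ≟ x)
      where
      not-clique : card A < d → Dec (a ≡ x) → ⊥
      not-clique A<d (no a≢x) = not-mates (clique A<d a∈A a≢x (inj₁ b∈A) (≢-sym (mates-distinct ab))) ab
      not-clique A<d (yes refl) = not-mates
        (sym H (clique A<d b∈A (≢-sym (mates-distinct ab)) (inj₁ a∈A) (mates-distinct ab))) ab

    -- Were `c` free, `u` would not be adjacent to it, and all neighbours of `u` would be `y` or in
    -- `A - u`: at most |A| < d vertices.
    small-free : card A < d → ∀ {u} → A ∋ u → Free u → VM ∋ c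
    small-free A<d {u} u∈A u-free = decidable-stable (VM ∋? c) λ c-free →
      <⇒≱ A<d (≤-trans (degrees u) (≤-trans (card≤suc (N G u) (A - u) y (sub c-free)) (shrink u∈A)))
      where
      sub : Free c → ∀ w → Adj G u w → w ≢ y → (A - u) ∋ w
      sub c-free w uw w≢y with neighbour u∈A (kept-free u-free uw)
      ... | inj₁ w∈A         = w∈A , λ { refl → irrefl G uw }
      ... | inj₂ (inj₁ refl) = contradiction uw (independent (inj₁ u∈A) (inj₂ refl) u-free c-free)
      ... | inj₂ (inj₂ w≡y)  = contradiction w≡y w≢y

    free-inner? : (∃ λ z → A ∋ z × z ≢ x × Free z) ⊎ (∀ v → A ∋ v → v ≢ x → VM ∋ v)
    free-inner? with any? (λ z → A ∋? z ×-dec ¬? (z ≟ x) ×-dec ¬? (VM ∋? z))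
    ... | yes found = inj₁ found
    ... | no  none  = inj₂ λ v v∈A v≢x → decidable-stable (VM ∋? v) λ v-free → none (v , v∈A , v≢x , v-free)

    only-x-free : (∀ v → A ∋ v → v ≢ x → VM ∋ v) → card A ≤ suc (card (A ∩ VM))
    only-x-free others = card≤suc A (A ∩ VM) x λ v v∈A v≢x → v∈A , others v v∈A v≢x

    large-covered : d ≤ card A → d ≤ 1 + card (A ∩ VM)
    large-covered d≤A with free-inner?
    ... | inj₁ (z , z∈A , z≢x , z-free) = free-inner z∈A z≢x z-free
    ... | inj₂ others                  = ≤-trans d≤A (only-x-free others)

    -- If a small end has no free vertex but `c` is free, then `c` takes over, being adjacent by
    -- `clique` to all of `A` except possibly `x`. In the remaining alternative, `A` and perhaps `c`
    -- use up at least d covered vertices.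
    handle : HasHandle A c ⊎ (A ⊆ VM × (VM ∋ c ⊎ d ≤ card A))
    handle with free-or-covered
    ... | inj₁ (u , u∈A , u-free) =
            inj₁ record { u = u ; u-free = u-free ; u∈ = inj₁ u∈A ; many = free-many u∈A u-free }
    ... | inj₂ A⊆VM with VM ∋? c | d ≤? card A
    ...   | yes c∈VM  | _       = inj₂ (A⊆VM , inj₁ c∈VM)
    ...   | _         | yes d≤A = inj₂ (A⊆VM , inj₂ d≤A)
    ...   | no c-free | no d≰A  = inj₁ record
            { u = c ; u-free = c-free ; u∈ = inj₂ (refl , ≰⇒> d≰A , A⊆VM) ; many = ≤-trans large (s≤s
                (card≤suc A (N G c ∩ (A ∩ VM)) x λ v v∈A v≢x →
                  proj₁ (sym H (clique (≰⇒> d≰A) v∈A v≢x (inj₂ refl) (λ { refl → c∉A v∈A }))) , v∈A , A⊆VM v∈A)) }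

  three-ends : ∀ {A x y c A′ x′ y′ c′ A″ x″ y″ c″} →
    End H A x y c → End H A′ x′ y′ c′ → End H A″ x″ y″ c″ →
    (∀ v → A ∋ v → ¬ A′ ∋ v) → (∀ v → A ∋ v → ¬ A″ ∋ v) → (∀ v → A′ ∋ v → ¬ A″ ∋ v) → ⊥
  three-ends e e′ e″ dis₁ dis₂ dis₃ = <-irrefl refl (begin-strict
    d + d + d                                    ≤⟨ +-mono-≤ (+-mono-≤ (bound E) (bound E′)) (bound E″) ⟩
    (2 + p E) + (2 + p E′) + (2 + p E″)          ≡⟨ regroup (p E) (p E′) (p E″) ⟩
    (2 + (p E + p E′ + p E″)) + 4                ≤⟨ +-monoˡ-≤ 4 (≤-trans (s≤s (s≤s pack)) card-VM) ⟩
    d + d + 4                                    <⟨ +-monoʳ-< (d + d) 5≤d ⟩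
    d + d + d                                    ∎)
    where
    open ≤-Reasoning
    E  = good-end e
    E′ = good-end e′
    E″ = good-end e″
    p : ∀ {S} → GoodEndIn S → ℕ
    p E = card (GoodEndIn.A E ∩ VM)
    bound : ∀ {S} (E : GoodEndIn S) → d ≤ 2 + p E
    bound E = GoodEnd.covered-bound (GoodEndIn.end E) (GoodEndIn.inner E)
    regroup : ∀ i j k → (2 + i) + (2 + j) + (2 + k) ≡ (2 + (i + j + k)) + 4
    regroup = solve-∀
    B  = GoodEndIn.A E ∩ VM
    B′ = GoodEndIn.A E′ ∩ VM
    B″ = GoodEndIn.A E″ ∩ VM
    i  = GoodEndIn.inside E
    i′ = GoodEndIn.inside E′
    i″ = GoodEndIn.inside E″
    pack : card B + card B′ + card B″ ≤ card VM
    pack = ≤-trans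
      (+-monoˡ-≤ (card B″) (card-pack (B ∪ B′) B B′ inj₁ inj₂
        (λ v v∈B v∈B′ → dis₁ v (i (proj₁ v∈B)) (i′ (proj₁ v∈B′)))))
      (card-pack VM (B ∪ B′) B″ [ proj₂ , proj₂ ]′ proj₂ λ v → λ where
        (inj₁ v∈B)  v∈B″ → dis₂ v (i (proj₁ v∈B)) (i″ (proj₁ v∈B″))
        (inj₂ v∈B′) v∈B″ → dis₃ v (i′ (proj₁ v∈B′)) (i″ (proj₁ v∈B″)))

  -- Two good ends

  -- The one configuration of two good ends that counting and exchanges leave over.
  record Tight (A A′ : DSet n) (c c′ : Fin n) : Set where
    field
      A<d     : card A < d
      A′<d    : card A′ < d
      c≡c′    : c ≡ c′
      exhaust : ∀ {v} → VM ∋ v → ¬ A ∋ v → ¬ A′ ∋ v → v ≢ c → ⊥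

  module TwoEnds {A x y c A′ x′ y′ c′} (e : End H A x y c) (inner : InnerRemovable H A c)
    (e′ : End H A′ x′ y′ c′) (inner′ : InnerRemovable H A′ c′)
    (disj : ∀ v → A ∋ v → ¬ A′ ∋ v) (c∉A′ : ¬ A′ ∋ c) (c′∉A : ¬ A ∋ c′) where

    private
      module E  = GoodEnd e inner
      module E′ = GoodEnd e′ inner′
      B = A ∩ VM
      B′ = A′ ∩ VM
      p = card B
      q = card B′
      disjoint : ∀ v → B ∋ v → ¬ B′ ∋ v
      disjoint v (v∈A , _) (v∈A′ , _) = disj v v∈A v∈A′

    bound₂ : 2 + (p + q) ≤ d + d
    bound₂ = ≤-trans (s≤s (s≤s (card-pack VM B B′ proj₂ proj₂ disjoint))) card-VM

    bound₃ : ∀ {m} → VM ∋ m → ¬ A ∋ m → ¬ A′ ∋ m → 3 + (p + q) ≤ d + d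
    bound₃ {m} m∈VM m∉A m∉A′ = ≤-trans (s≤s (s≤s (≤-trans (s≤s
      (card-pack (VM - m) B B′ (λ { (v∈A , v∈) → v∈ , λ { refl → m∉A v∈A } })
        (λ { (v∈A′ , v∈) → v∈ , λ { refl → m∉A′ v∈A′ } }) disjoint))
      (card-strict (VM - m) VM m proj₁ m∈VM (λ (_ , m≢m) → m≢m refl))))) card-VM

    bound₄ : ∀ {m k} → m ≢ k → VM ∋ m → ¬ A ∋ m → ¬ A′ ∋ m → VM ∋ k → ¬ A ∋ k → ¬ A′ ∋ k →
      4 + (p + q) ≤ d + d
    bound₄ {m} {k} m≢k m∈VM m∉A m∉A′ k∈VM k∉A k∉A′ = ≤-trans (s≤s (s≤s (≤-trans (s≤s (s≤s
      (card-pack (VM - m - k) B B′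
        (λ { (v∈A , v∈) → (v∈ , λ { refl → m∉A v∈A }) , λ { refl → k∉A v∈A } })
        (λ { (v∈A′ , v∈) → (v∈ , λ { refl → m∉A′ v∈A′ }) , λ { refl → k∉A′ v∈A′ } }) disjoint)))
      (card-strict² (VM - m - k) VM m k m≢k (proj₁ ∘ proj₁) m∈VM k∈VM
        (λ ((_ , m≢m) , _) → m≢m refl) (λ (_ , k≢k) → k≢k refl))))) card-VM

    -- So much of the budget is spent at `A` that `A′` holds at most d - 2 covered vertices. Hence
    -- `A′` is small with a free vertex, and `c′` is covered by `small-free`. Now any covered vertex
    -- outside both ends besides a common `c` exceeds the budget.
    no-handle : A ⊆ VM → VM ∋ c ⊎ d ≤ card A → Tight A A′ c c′
    no-handle A⊆VM c∈VM⊎d≤A = cases E′.free-or-covered (d ≤? card A′)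
      where
      A≤p : card A ≤ p
      A≤p = card-⊆ A B (λ v∈A → v∈A , A⊆VM v∈A)
      impossible : d ≤ 1 + q → ⊥
      impossible d≤1+q = case c∈VM⊎d≤A of λ where
        (inj₁ c∈VM) → squeeze 3 1 1 (bound₃ c∈VM (End.c∉A e) c∉A′) (E.all-covered A⊆VM) d≤1+q (s≤s (s≤s (s≤s z≤n)))
        (inj₂ d≤A)  → squeeze 2 0 1 bound₂ (≤-trans d≤A A≤p) d≤1+q (s≤s (s≤s z≤n))
      cases : (∃ λ u → A′ ∋ u × Free u) ⊎ A′ ⊆ VM → Dec (d ≤ card A′) → Tight A A′ c c′
      cases (inj₂ A′⊆VM) _ = ⊥-elim (impossible (E′.all-covered A′⊆VM))
      cases (inj₁ _) (yes d≤A′) = ⊥-elim (impossible (E′.large-covered d≤A′))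
      cases (inj₁ (u , u∈A′ , u-free)) (no d≰A′) =
        record { A<d = A<d ; A′<d = A′<d ; c≡c′ = c≡c′ ; exhaust = exhaust }
        where
        A′<d : card A′ < d
        A′<d = ≰⇒> d≰A′
        c′∈VM : VM ∋ c′
        c′∈VM = E′.small-free A′<d u∈A′ u-free
        A<d : card A < d
        A<d = ≰⇒> λ d≤A → squeeze 3 0 2 (bound₃ c′∈VM c′∉A (End.c∉A e′)) (≤-trans d≤A A≤p)
          E′.covered-bound (s≤s (s≤s (s≤s z≤n)))
        c∈VM : VM ∋ c
        c∈VM = [ (λ c∈ → c∈) , (λ d≤A → contradiction d≤A (<⇒≱ A<d)) ]′ c∈VM⊎d≤A
        crowded : ∀ {m k} → m ≢ k → VM ∋ m → ¬ A ∋ m → ¬ A′ ∋ m → VM ∋ k → ¬ A ∋ k → ¬ A′ ∋ k → ⊥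
        crowded m≢k m∈ m∉A m∉A′ k∈ k∉A k∉A′ = squeeze 4 1 2 (bound₄ m≢k m∈ m∉A m∉A′ k∈ k∉A k∉A′)
          (E.all-covered A⊆VM) E′.covered-bound (s≤s (s≤s (s≤s (s≤s z≤n))))
        c≡c′ : c ≡ c′
        c≡c′ = decidable-stable (c ≟ c′) λ c≢c′ →
          crowded c≢c′ c∈VM (End.c∉A e) c∉A′ c′∈VM c′∉A (End.c∉A e′)
        exhaust : ∀ {v} → VM ∋ v → ¬ A ∋ v → ¬ A′ ∋ v → v ≢ c → ⊥
        exhaust v∈ v∉A v∉A′ v≢c = crowded v≢c v∈ v∉A v∉A′ c∈VM (End.c∉A e) c∉A′

    -- The counts make `c` free and leave fewer than `d` covered vertices in `A`, so by
    -- `free-inner-c` only `x` can be free in `A`, and `u` is `x`. Without `c` as a neighbour, `b`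
    -- would have too small a degree. The exchange of ab for ua and cb is then refuted by the edge
    -- ub.
    inner-mates : ∀ {a b} → d ≤ card A → d ≤ 1 + q → ∀ {u} → A ∋ u → Free u → Mate M a b →
      A ∋ a → A ∋ b → Adj G u a → Adj G u b → ⊥
    inner-mates {a} {b} d≤A d≤1+q {u} u∈A u-free ab a∈A b∈A ua ub = cases E.free-inner?
      where
      d≤1+p : d ≤ 1 + p
      d≤1+p = E.large-covered d≤A
      c-free : Free c
      c-free c∈VM = squeeze 3 1 1 (bound₃ c∈VM (End.c∉A e) c∉A′) d≤1+p d≤1+q (s≤s (s≤s (s≤s z≤n)))
      too-many : d ≤ p → ⊥
      too-many d≤p = squeeze 2 0 1 bound₂ d≤p d≤1+q (s≤s (s≤s z≤n))
      cases : (∃ λ z → A ∋ z × z ≢ x × Free z) ⊎ (∀ v → A ∋ v → v ≢ x → VM ∋ v) → ⊥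
      cases (inj₁ (z , z∈A , z≢x , z-free)) = too-many (E.free-inner-c z∈A z≢x z-free c-free)
      cases (inj₂ others) = exchange-triangle ab (λ { refl → End.c∉A e u∈A }) u-free c-free ua ub
        (proj₁ (sym H bc)) (inner (inj₁ a∈A) (inj₁ u∈A) (sym H (kept-free u-free ua)))
        (inner (inj₁ b∈A) (inj₂ refl) bc)
        where
        b≢x : b ≢ x
        b≢x refl with u ≟ x
        ... | yes refl = irrefl G ub
        ... | no  u≢x  = u-free (others u u∈A u≢x)
        bc : Adj H b c
        bc = decidable-stable (adj? H b c) λ ¬bc → too-many (≤-trans (degreeH b) (s≤s⁻¹ (≤-trans
          (s≤s (s≤s (card-⊆ (N H b) (A - b - a) (sub ¬bc))))
          (≤-trans (card-strict² (A - b - a) A b a (≢-sym (mates-distinct ab)) (proj₁ ∘ proj₁) b∈A a∈A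
            (λ ((_ , b≢b) , _) → b≢b refl) (λ (_ , a≢a) → a≢a refl)) (E.only-x-free others)))))
          where
          sub : ¬ Adj H b c → N H b ⊆ A - b - a
          sub ¬bc {w} bw with E.inner-neighbour b∈A b≢x bw
          ... | inj₁ w∈A  = (w∈A , λ { refl → irrefl H bw }) , λ { refl → not-mates (sym H bw) ab }
          ... | inj₂ refl = contradiction bw ¬bc

    -- If no matching edge joins the two handles' neighbourhoods X and Y, then counting X twice
    -- and Y once finds a matching edge with both ends in X.
    linked-or-inner : ∀ (X Y : DSet n) → X ⊆ A ∩ VM → Y ⊆ A′ ∩ VM → d ≤ 2 + card X → d ≤ 2 + card Y →
      (∃₂ λ a b → Mate M a b × X ∋ a × Y ∋ b) ⊎ (∃₂ λ a b → Mate M a b × X ∋ a × X ∋ b)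
    linked-or-inner X Y X⊆ Y⊆ d≤X d≤Y
      with find (heavy-edge w M (s≤s⁻¹ (s≤s⁻¹ (s≤s⁻¹ (s≤s⁻¹ (s≤s⁻¹ (s≤s⁻¹ heavy)))))))
      where
      open ≤-Reasoning
      w : Fin n → ℕ
      w v = ind X v + ind X v + ind Y v
      covers : ∀ v → w v ≡ 0 ⊎ Covered M v
      covers v with X ∋? v | Y ∋? v
      ... | yes v∈X | _       = inj₂ (proj₂ (X⊆ v∈X))
      ... | no _    | yes v∈Y = inj₂ (proj₂ (Y⊆ v∈Y))
      ... | no _    | no _    = inj₁ refl
      total : card X + card X + card Y ≡ sum w
      total = ≡-sym (≡-trans (∑-distrib-+ (λ v → ind X v + ind X v) (ind Y))
                             (cong (_+ card Y) (∑-distrib-+ (ind X) (ind X))))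
      regroup : ∀ i j → (2 + i) + (2 + i) + (2 + j) ≡ 6 + (i + i + j)
      regroup = solve-∀
      -- The total is at least 3(d - 2) ≥ 2d - 1 > 2|M| by d ≥ 5; the 6 on both sides avoids
      -- subtraction.
      heavy : 6 + suc (length M + length M) ≤ 6 + weight w M
      heavy = begin
        6 + suc (length M + length M)                   ≡⟨ +-comm 5 (2 + (length M + length M)) ⟩
        2 + (length M + length M) + 5                   ≤⟨ +-mono-≤ 2∣M∣≤ 5≤d ⟩
        d + d + d                                       ≤⟨ +-mono-≤ (+-mono-≤ d≤X d≤X) d≤Y ⟩
        (2 + card X) + (2 + card X) + (2 + card Y)      ≡⟨ regroup (card X) (card Y) ⟩
        6 + (card X + card X + card Y)                  ≡⟨ cong (6 +_) total ⟩
        6 + sum w                                       ≤⟨ +-monoʳ-≤ 6 (sum≤weight w M covers) ⟩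
        6 + weight w M                                  ∎
    ... | (a , b) , ab∈M , 3≤ with X ∋? a | X ∋? b | Y ∋? a | Y ∋? b
    ...   | yes a∈X | yes b∈X | _ | _       = inj₂ (a , b , inj₁ ab∈M , a∈X , b∈X)
    ...   | yes a∈X | no _    | _ | yes b∈Y = inj₁ (a , b , inj₁ ab∈M , a∈X , b∈Y)
    ...   | no _    | yes b∈X | yes a∈Y | _ = inj₁ (b , a , inj₂ ab∈M , b∈X , a∈Y)
    ...   | yes a∈X | no _    | yes a∈Y | no _  = ⊥-elim (disjoint a (X⊆ a∈X) (Y⊆ a∈Y))
    ...   | yes _   | no _    | no _    | no _  = contradiction 3≤ λ { (s≤s (s≤s ())) }
    ...   | no _    | yes b∈X | no _    | yes b∈Y = ⊥-elim (disjoint b (X⊆ b∈X) (Y⊆ b∈Y))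
    ...   | no _    | yes _   | no _    | no _  = contradiction 3≤ λ { (s≤s (s≤s ())) }
    ...   | no _    | no _    | yes _   | yes _ = contradiction 3≤ λ { (s≤s (s≤s ())) }
    ...   | no _    | no _    | yes _   | no _  = contradiction 3≤ λ { (s≤s ()) }
    ...   | no _    | no _    | no _    | yes _ = contradiction 3≤ λ { (s≤s ()) }
    ...   | no _    | no _    | no _    | no _  = contradiction 3≤ λ ()

    -- A common handle can only be the common attachment vertex, and such handles come with small,
    -- fully covered ends, which already hold all 2d - 2 possible covered vertices.
    same-handle : (h : HasHandle A c) (h′ : HasHandle A′ c′) → HasHandle.u h ≡ HasHandle.u h′ → Tight A A′ c c′
    same-handle h h′ u≡v = cases (HasHandle.u∈ h) (HasHandle.u∈ h′) u≡v
      where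
      outside-A : ∀ {v} → A′ ∋ v ⊎ v ≡ c′ → ¬ A ∋ v
      outside-A (inj₁ v∈A′) v∈A = disj _ v∈A v∈A′
      outside-A (inj₂ refl)     = c′∉A
      outside-A′ : ∀ {u} → A ∋ u ⊎ u ≡ c → ¬ A′ ∋ u
      outside-A′ (inj₁ u∈A) = disj _ u∈A
      outside-A′ (inj₂ refl) = c∉A′
      cases : ∀ {u v} → A ∋ u ⊎ (u ≡ c × card A < d × A ⊆ VM) →
        A′ ∋ v ⊎ (v ≡ c′ × card A′ < d × A′ ⊆ VM) → u ≡ v → Tight A A′ c c′
      cases (inj₁ u∈A) v∈ refl = contradiction u∈A (outside-A ([ inj₁ , inj₂ ∘ proj₁ ]′ v∈))
      cases (inj₂ (u≡c , _)) (inj₁ v∈A′) refl = contradiction v∈A′ (outside-A′ (inj₂ u≡c))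
      cases (inj₂ (refl , A<d , A⊆VM)) (inj₂ (c≡c′ , A′<d , A′⊆VM)) refl = record
        { A<d = A<d ; A′<d = A′<d ; c≡c′ = c≡c′
        ; exhaust = λ v∈VM v∉A v∉A′ _ → squeeze 3 1 1 (bound₃ v∈VM v∉A v∉A′)
            (E.all-covered A⊆VM) (E′.all-covered A′⊆VM) (s≤s (s≤s (s≤s z≤n))) }

    linked : (h : HasHandle A c) (h′ : HasHandle A′ c′) → HasHandle.u h ≢ HasHandle.u h′ →
      ∀ {a b} → Mate M a b → A ∋ a → A′ ∋ b → Adj G (HasHandle.u h) a → Adj G (HasHandle.u h′) b → ⊥
    linked h h′ u≢v ab a∈A b∈A′ ua vb =
      exchange-ends e e′ disj c∉A′ c′∉A a∈A (HasHandle.u∈D h) b∈A′ (HasHandle.u∈D h′) ab u≢v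
        (HasHandle.u-free h) (HasHandle.u-free h′) ua vb
        (inner (inj₁ a∈A) (HasHandle.u∈D h) (sym H (kept-free (HasHandle.u-free h) ua)))
        (inner′ (inj₁ b∈A′) (HasHandle.u∈D h′) (sym H (kept-free (HasHandle.u-free h′) vb)))

    inner-edge : (h : HasHandle A c) (h′ : HasHandle A′ c′) → HasHandle.u h ≢ HasHandle.u h′ →
      ∃₂ λ a b → Mate M a b × A ∋ a × A ∋ b × Adj G (HasHandle.u h) a × Adj G (HasHandle.u h) b
    inner-edge h h′ u≢v = cases (linked-or-inner X Y proj₂ proj₂ (HasHandle.many h) (HasHandle.many h′))
      where
      X Y : DSet n
      X = N G (HasHandle.u h) ∩ (A ∩ VM)
      Y = N G (HasHandle.u h′) ∩ (A′ ∩ VM)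
      cases : (∃₂ λ a b → Mate M a b × X ∋ a × Y ∋ b) ⊎ (∃₂ λ a b → Mate M a b × X ∋ a × X ∋ b) →
        ∃₂ λ a b → Mate M a b × A ∋ a × A ∋ b × Adj G (HasHandle.u h) a × Adj G (HasHandle.u h) b
      cases (inj₁ (a , b , ab , (ua , a∈A , _) , (vb , b∈A′ , _))) = ⊥-elim (linked h h′ u≢v ab a∈A b∈A′ ua vb)
      cases (inj₂ (a , b , ab , (ua , a∈A , _) , (ub , b∈A , _))) = a , b , ab , a∈A , b∈A , ua , ub

    inner-edge-absurd : (h : HasHandle A c) → d ≤ 1 + q →
      (∃₂ λ a b → Mate M a b × A ∋ a × A ∋ b × Adj G (HasHandle.u h) a × Adj G (HasHandle.u h) b) → ⊥
    inner-edge-absurd h d≤1+q (a , b , ab , a∈A , b∈A , ua , ub) =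
      inner-mates d≤A d≤1+q u∈A (HasHandle.u-free h) ab a∈A b∈A ua ub
      where
      d≤A : d ≤ card A
      d≤A = E.mates-inside a∈A b∈A ab
      u∈A : A ∋ HasHandle.u h
      u∈A = [ (λ u∈A → u∈A) , (λ (_ , A<d , _) → contradiction d≤A (<⇒≱ A<d)) ]′ (HasHandle.u∈ h)

  -- For distinct handles, a matching edge linking their neighbourhoods is excluded by
  -- `exchange-ends`, so each end contains a matching edge. By `mates-inside` both ends are then
  -- large, and `inner-mates` applies.
  tight : ∀ {A x y c A′ x′ y′ c′} → End H A x y c → InnerRemovable H A c →
    End H A′ x′ y′ c′ → InnerRemovable H A′ c′ →
    (∀ v → A ∋ v → ¬ A′ ∋ v) → ¬ A′ ∋ c → ¬ A ∋ c′ → Tight A A′ c c′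
  tight {A} {c = c} {A′} {c′ = c′} e inner e′ inner′ disj c∉A′ c′∉A =
    by-handles (GoodEnd.handle e inner) (GoodEnd.handle e′ inner′)
    where
    disj′ : ∀ v → A′ ∋ v → ¬ A ∋ v
    disj′ v v∈A′ v∈A = disj v v∈A v∈A′

    flip-tight : Tight A′ A c′ c → Tight A A′ c c′
    flip-tight tight = record
      { A<d = A′<d ; A′<d = A<d ; c≡c′ = ≡-sym c≡c′
      ; exhaust = λ v∈ v∉A v∉A′ v≢c → exhaust v∈ v∉A′ v∉A (λ v≡c′ → v≢c (≡-trans v≡c′ c≡c′)) }
      where open Tight tight

    by-handles : HasHandle A c ⊎ (A ⊆ VM × (VM ∋ c ⊎ d ≤ card A)) →
      HasHandle A′ c′ ⊎ (A′ ⊆ VM × (VM ∋ c′ ⊎ d ≤ card A′)) → Tight A A′ c c′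
    by-handles (inj₂ (A⊆VM , c∈)) _ = TwoEnds.no-handle e inner e′ inner′ disj c∉A′ c′∉A A⊆VM c∈
    by-handles (inj₁ _) (inj₂ (A′⊆VM , c′∈)) =
      flip-tight (TwoEnds.no-handle e′ inner′ e inner disj′ c′∉A c∉A′ A′⊆VM c′∈)
    by-handles (inj₁ h) (inj₁ h′) = by-equality (HasHandle.u h ≟ HasHandle.u h′)
      where
      by-equality : Dec (HasHandle.u h ≡ HasHandle.u h′) → Tight A A′ c c′
      by-equality (yes u≡v) = TwoEnds.same-handle e inner e′ inner′ disj c∉A′ c′∉A h h′ u≡v
      by-equality (no  u≢v) =
        let (_ , _ , ab′ , a′∈ , b′∈ , _) = TwoEnds.inner-edge e′ inner′ e inner disj′ c′∉A c∉A′ h′ h (≢-sym u≢v)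
            d≤1+q = GoodEnd.large-covered e′ inner′ (GoodEnd.mates-inside e′ inner′ a′∈ b′∈ ab′)
        in ⊥-elim (TwoEnds.inner-edge-absurd e inner e′ inner′ disj c∉A′ c′∉A h d≤1+q
             (TwoEnds.inner-edge e inner e′ inner′ disj c∉A′ c′∉A h h′ u≢v))

  -- Two small ends with a common attachment vertex c are cliques joined to c; every edge of H - c
  -- at a vertex w outside both of them then bounds an end on the far side of w.
  two-ends : ∀ {A x y c A′ x′ y′ c′} → End H A x y c → InnerRemovable H A c →
    End H A′ x′ y′ c′ → InnerRemovable H A′ c′ →
    (∀ v → A ∋ v → ¬ A′ ∋ v) → ¬ A′ ∋ c → ¬ A ∋ c′ → ⊥
  two-ends {A} {x} {y} {c} {A′} {x′} {y′} e inner e′ inner′ disj c∉A′ c′∉A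
    with tight e inner e′ inner′ disj c∉A′ c′∉A
  ... | record { A<d = A<d ; A′<d = A′<d ; c≡c′ = refl ; exhaust = exhaust } =
    let (s₁ , ws₁ , s₁≢c , _)           = fourth-neighbour w c c c
        (s₂ , ws₂ , s₂≢c , s₂≢s₁ , _)    = fourth-neighbour w c s₁ s₁
        (s₃ , ws₃ , s₃≢c , s₃≢s₁ , s₃≢s₂) = fourth-neighbour w c s₁ s₂
        (_ , e₁) = far-end ws₁ s₁≢c
        (_ , e₂) = far-end ws₂ s₂≢c
        (_ , e₃) = far-end ws₃ s₃≢c
    in three-ends e₁ e₂ e₃ (far-sides-disjoint e₁ e₂ (≢-sym s₂≢s₁))
         (far-sides-disjoint e₁ e₃ (≢-sym s₃≢s₁)) (far-sides-disjoint e₂ e₃ (≢-sym s₃≢s₂))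
    where
    S : DSet n
    S = A ∪ A′ ∪ ⁅ c ⁆

    outside : ∃ λ w → ⊤ × ¬ S ∋ w
    outside = card-pick full S (begin-strict
      card S                            ≤⟨ card-cover S (A ∪ A′) ⁅ c ⁆ (λ _ v∈ → v∈) ⟩
      card (A ∪ A′) + card ⁅ c ⁆        ≡⟨ cong (card (A ∪ A′) +_) (card-⁅⁆ c) ⟩
      card (A ∪ A′) + 1                 ≤⟨ +-monoˡ-≤ 1 (card-cover (A ∪ A′) A A′ (λ _ v∈ → v∈)) ⟩
      card A + card A′ + 1              ≡⟨ +-comm _ 1 ⟩
      suc (card A + card A′)            <⟨ ≤-refl ⟩
      suc (suc (card A + card A′))      ≡⟨ cong suc (≡-sym (+-suc (card A) _)) ⟩
      suc (card A) + suc (card A′)      ≤⟨ +-mono-≤ A<d A′<d ⟩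
      d + d                             ≤⟨ 2d≤n ⟩
      n                                 ≡⟨ ≡-sym (card-full n) ⟩
      card {n} full                     ∎)
      where open ≤-Reasoning

    w : Fin n
    w = proj₁ outside
    w∉A : ¬ A ∋ w
    w∉A w∈A = proj₂ (proj₂ outside) (inj₁ (inj₁ w∈A))
    w∉A′ : ¬ A′ ∋ w
    w∉A′ w∈A′ = proj₂ (proj₂ outside) (inj₁ (inj₂ w∈A′))
    w≢c : w ≢ c
    w≢c w≡c = proj₂ (proj₂ outside) (inj₂ w≡c)

    free-outside : ∀ {v} → ¬ A ∋ v → ¬ A′ ∋ v → v ≢ c → Free v
    free-outside v∉A v∉A′ v≢c v∈VM = exhaust v∈VM v∉A v∉A′ v≢c

    -- Starting from `c`, the clique is entered at `v₀`, which is chosen different from `xB` and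
    -- `d′`, and every other vertex is one step further. An edge can leave `Z` only to `d′` or `z₂`,
    -- and neither is a target here.
    absorbed : ∀ {Z z₁ z₂ d′ B xB yB} (eB : End H B xB yB c) → InnerRemovable H B c → card B < d →
      End H Z z₁ z₂ d′ → Z ∋ c → ¬ B ∋ z₂ → ∀ {v} → B ∋ v → v ≢ d′ → Z ∋ v
    absorbed {Z} {z₁} {z₂} {d′} {B} {xB} eB innerB B<d eZ c∈Z z₂∉B {v} v∈B v≢d′ = all (v ≟ v₀)
      where
      module B = GoodEnd eB innerB
      v₀ : Fin n
      v₀ = proj₁ (B.inner-vertex d′)
      v₀∈B : B ∋ v₀
      v₀∈B = proj₁ (proj₂ (B.inner-vertex d′))
      v₀≢xB : v₀ ≢ xB
      v₀≢xB = proj₁ (proj₂ (proj₂ (B.inner-vertex d′)))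
      v₀≢d′ : v₀ ≢ d′
      v₀≢d′ = proj₂ (proj₂ (proj₂ (B.inner-vertex d′)))
      step : ∀ {r s} → Z ∋ r → Adj H r s → B ∋ s → s ≢ d′ → Z ∋ s
      step {r} {s} r∈Z rs s∈B s≢d′ = decidable-stable (Z ∋? s) λ s∉Z →
        [ s≢d′ , (λ (_ , s≡z₂) → z₂∉B (subst (B ∋_) s≡z₂ s∈B)) ]′ (End.leaves eZ r∈Z s∉Z rs)
      v₀∈Z : Z ∋ v₀
      v₀∈Z = step c∈Z (sym H (B.clique B<d v₀∈B v₀≢xB (inj₂ refl)
               (λ c≡v₀ → End.c∉A eB (subst (B ∋_) (≡-sym c≡v₀) v₀∈B)))) v₀∈B v₀≢d′
      all : Dec (v ≡ v₀) → Z ∋ v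
      all (yes refl)  = v₀∈Z
      all (no  v≢v₀) = step v₀∈Z (B.clique B<d v₀∈B v₀≢xB (inj₁ v∈B) v≢v₀) v∈B v≢d′

    same-side : ∀ {Z z₁ z₂ d′} → End H Z z₁ z₂ d′ → Z ∋ c → ¬ A ∋ z₂ → ¬ A′ ∋ z₂ → ⊥
    same-side {Z} {d′ = d′} eZ c∈Z z₂∉A z₂∉A′ = three-ends e e′ (flip-end eZ) disj
      (λ v v∈A (v∉Z , v≢d′) → v∉Z (absorbed e inner A<d eZ c∈Z z₂∉A v∈A v≢d′))
      (λ v v∈A′ (v∉Z , v≢d′) → v∉Z (absorbed e′ inner′ A′<d eZ c∈Z z₂∉A′ v∈A′ v≢d′))

    -- If `s` is in `A` or `A′`, that end itself serves. Otherwise `s` and `w` are free, so sw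
    -- cannot be deleted. An end of sw attached elsewhere than at `c` would have both cliques on the
    -- side of `c`, up to its attachment vertex, and its other side would be a third disjoint end.
    far-end : ∀ {s} → Adj H w s → s ≢ c → ∃ λ Z → End H Z s w c
    far-end {s} ws s≢c with A ∋? s | A′ ∋? s
    ... | yes s∈A | _ with End.leaves e s∈A w∉A (sym H ws)
    ...   | inj₁ w≡c           = contradiction w≡c w≢c
    ...   | inj₂ (refl , w≡y) = A , subst (λ y → End H A s y c) (≡-sym w≡y) e
    far-end {s} ws s≢c | no _ | yes s∈A′ with End.leaves e′ s∈A′ w∉A′ (sym H ws)
    ...   | inj₁ w≡c           = contradiction w≡c w≢c
    ...   | inj₂ (refl , w≡y) = A′ , subst (λ y → End H A′ s y c) (≡-sym w≡y) e′
    far-end {s} ws s≢c | no s∉A | no s∉A′ with crossed-or-not (H -ₑ (s , w))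
    ...   | inj₁ cr = ⊥-elim (add-edge (free-outside s∉A s∉A′ s≢c) (free-outside w∉A w∉A′ w≢c)
                        (sym G (proj₁ ws)) cr)
    ...   | inj₂ un with ¬removable⇒end crossed (sym H ws) un
    ...     | Z , c″ , eZ with c″ ≟ c
    ...       | yes refl = Z , eZ
    ...       | no c″≢c with Z ∋? c
    ...         | yes c∈Z = ⊥-elim (same-side eZ c∈Z w∉A w∉A′)
    ...         | no  c∉Z = ⊥-elim (same-side (flip-end eZ) (c∉Z , ≢-sym c″≢c) s∉A s∉A′)

  -- No ends remain: the final exchange

  no-end : ∀ {A x y c} → ¬ End H A x y c
  no-end e with good-end e
  ... | record { A = A ; c = c ; end = e₁ ; inner = inner₁ }
    with good-end-avoiding e₁ (flip-end e₁) (λ v v∈A (v∉A , _) → v∉A v∈A) (λ (_ , c≢c) → c≢c refl)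
  ...   | record { end = e₂ ; inside = inside₂ ; inner = inner₂ } , c₂∉A =
    two-ends e₁ inner₁ e₂ inner₂ (λ v v∈A v∈A₂ → proj₁ (inside₂ v∈A₂) v∈A)
      (λ c∈A₂ → proj₂ (inside₂ c∈A₂) refl) c₂∉A

  removable : ∀ {u v} → Adj H u v → Crossed (H -ₑ (u , v))
  removable {u} {v} uv with crossed-or-not (H -ₑ (u , v))
  ... | inj₁ cr = cr
  ... | inj₂ un = ⊥-elim (no-end (proj₂ (proj₂ (¬removable⇒end crossed uv un))))

  triangle : ∀ {a b u v} → Mate M a b → u ≢ v → Free u → Free v → Adj G u a → Adj G u b → Adj G v b → ⊥
  triangle mate u≢v u-free v-free ua ub vb = exchange-triangle mate u≢v u-free v-free ua ub vb
    (removable (sym H (kept-free u-free ua))) (removable (sym H (kept-free v-free vb)))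

  two-free : ∃₂ λ u v → u ≢ v × Free u × Free v
  two-free =
    let (u , _ , u-free) = card-pick full VM (≤-trans (s≤s (n≤1+n _)) enough)
        (v , _ , v∉)     = card-pick full (VM ∪ ⁅ u ⁆) (≤-trans (s≤s
          (card≤suc (VM ∪ ⁅ u ⁆) VM u λ v v∈ v≢u → [ (λ v∈VM → v∈VM) , (λ v≡u → contradiction v≡u v≢u) ]′ v∈)) enough)
    in u , v , (λ u≡v → v∉ (inj₂ (≡-sym u≡v))) , u-free , v∉ ∘ inj₁
    where
    enough : 2 + card VM ≤ card {n} full
    enough = ≤-trans card-VM (≤-trans 2d≤n (≤-reflexive (≡-sym (card-full n))))

  absurd : ⊥
  absurd with two-free
  ... | u , v , u≢v , u-free , v-free with find (heavy-edge w M heavy)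
    where
    covered-nbr : ∀ {z} → Free z → ∀ {t} → Adj G z t → VM ∋ t
    covered-nbr z-free {t} zt = decidable-stable (VM ∋? t) λ t-free →
      add-edge z-free t-free zt (removable (kept-free z-free zt))
    w : Fin n → ℕ
    w t = ind (N G u) t + ind (N G v) t
    covers : ∀ t → w t ≡ 0 ⊎ Covered M t
    covers t with adj? G u t | adj? G v t
    ... | yes ut | _      = inj₂ (covered-nbr u-free ut)
    ... | no _   | yes vt = inj₂ (covered-nbr v-free vt)
    ... | no _   | no _   = inj₁ refl
    open ≤-Reasoning
    -- At least 2d > 2|M| edges run from `u` and `v` to covered vertices, so some edge ab of `M`
    -- receives three of the four possible ones. One of `u`, `v` is then adjacent to both `a` and
    -- `b`, as `triangle` requires.
    heavy : length M + length M < weight w M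
    heavy = begin-strict
      length M + length M             <⟨ n≤1+n _ ⟩
      2 + (length M + length M)       ≤⟨ 2∣M∣≤ ⟩
      d + d                           ≤⟨ +-mono-≤ (degrees u) (degrees v) ⟩
      card (N G u) + card (N G v)     ≡⟨ ≡-sym (∑-distrib-+ (ind (N G u)) (ind (N G v))) ⟩
      sum w                           ≤⟨ sum≤weight w M covers ⟩
      weight w M                      ∎
  ... | (a , b) , ab∈M , 3≤ with adj? G u a | adj? G u b | adj? G v a | adj? G v b
  ...   | yes ua | yes ub | _      | yes vb = triangle (inj₁ ab∈M) u≢v u-free v-free ua ub vb
  ...   | yes ua | yes ub | yes va | no _   = triangle (inj₂ ab∈M) u≢v u-free v-free ub ua va
  ...   | no _   | yes ub | yes va | yes vb = triangle (inj₁ ab∈M) (≢-sym u≢v) v-free u-free va vb ub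
  ...   | yes ua | no _   | yes va | yes vb = triangle (inj₂ ab∈M) (≢-sym u≢v) v-free u-free vb va ua
  ...   | yes _  | yes _  | no _   | no _   = contradiction 3≤ λ { (s≤s (s≤s ())) }
  ...   | yes _  | no _   | yes _  | no _   = contradiction 3≤ λ { (s≤s (s≤s ())) }
  ...   | yes _  | no _   | no _   | yes _  = contradiction 3≤ λ { (s≤s (s≤s ())) }
  ...   | yes _  | no _   | no _   | no _   = contradiction 3≤ λ { (s≤s ()) }
  ...   | no _   | yes _  | yes _  | no _   = contradiction 3≤ λ { (s≤s (s≤s ())) }
  ...   | no _   | yes _  | no _   | yes _  = contradiction 3≤ λ { (s≤s (s≤s ())) }
  ...   | no _   | yes _  | no _   | no _   = contradiction 3≤ λ { (s≤s ()) }
  ...   | no _   | no _   | yes _  | yes _  = contradiction 3≤ λ { (s≤s (s≤s ())) }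
  ...   | no _   | no _   | yes _  | no _   = contradiction 3≤ λ { (s≤s ()) }
  ...   | no _   | no _   | no _   | yes _  = contradiction 3≤ λ { (s≤s ()) }
  ...   | no _   | no _   | no _   | no _   = contradiction 3≤ λ ()

-- Finite search

list? : ∀ {P : EdgeList n → Set} → (∀ M → Dec (P M)) → ∀ ℓ → Dec (∃ λ M → length M ≡ ℓ × P M)
list? P? zero = map′ (λ p → [] , refl , p) (λ { ([] , refl , p) → p }) (P? [])
list? P? (suc ℓ) = map′
  (λ (u , v , M , len , p) → (u , v) ∷ M , cong suc len , p)
  (λ { ((u , v) ∷ M , refl , p) → u , v , M , refl , p })
  (any? λ u → any? λ v → list? (λ M → P? ((u , v) ∷ M)) ℓ)

matching? : ∀ (G : Graph n) M → Dec (Matching G M)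
matching? G M = map′
  (λ (e , d) → record { edges = e ; disjoint = d })
  (λ m → Matching.edges m , Matching.disjoint m)
  (All.all? (λ (u , w) → adj? G u w) M ×-dec allPairs? disjoint? M)
  where
  disjoint? : Decidable Disjoint
  disjoint? (u , w) (x , y) = ¬? (u ≟ x) ×-dec ¬? (u ≟ y) ×-dec ¬? (w ≟ x) ×-dec ¬? (w ≟ y)

twoConnected? : 3 ≤ n → ∀ (K : Graph n) → Dec (TwoConnected K)
twoConnected? 3≤n K with crossed-or-not K
... | inj₁ cr = yes (crossed⇒twoConnected 3≤n cr)
... | inj₂ un = no λ tc → crossed⇒¬uncrossed (twoConnected⇒crossed tc) un

δ-min : ∀ (G : Graph n) v → δ G ≤ card (N G v)
δ-min {n} G v = ≤-trans (All.lookup (min≤xs n _) (∈-map⁺ (degree G) (∈-allFin v)))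
                    (≤-reflexive (degree≡card G v))

-- Existence of a larger removable matching is decidable by finite search, so refuting its absence
-- yields one.
augment : ∀ (G : Graph n) d → 5 ≤ d → (∀ v → d ≤ card (N G v)) → d + d ≤ n →
  ∀ M → length M < d → Matching G M → TwoConnected (G -ᴱ M) →
  ∃ λ M′ → length M′ ≡ suc (length M) × Matching G M′ × TwoConnected (G -ᴱ M′)
augment G d 5≤d degrees 2d≤n M short mat tc = decidable-stable
  (list? (λ M′ → matching? G M′ ×-dec twoConnected? 3≤n (G -ᴱ M′)) (suc (length M)))
  λ none → Augment.absurd G d 5≤d degrees 2d≤n M short mat (twoConnected⇒crossed tc)
    λ M′ mat′ len cr → none (M′ , len , mat′ , crossed⇒twoConnected 3≤n cr)
  where
  3≤n = TwoConnected.atLeast3 tc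

theorem1p1 : (d : ℕ) → d ≥ 5 → (n : ℕ) (G : Graph n) → TwoConnected G →
    δ G ≥ d → ∣V G ∣ ≥ 2 * d →
    ∃[ M ] (ℓ-Matching d G M × Removable G M)
theorem1p1 d d≥5 n G tc δ≥d ∣V∣≥2d =
  let (M , len , mat , tcM) = grow d ≤-refl
  in M , record { matching = mat ; size = len } , tcM
  where
  grow : ∀ k → k ≤ d → ∃ λ M → length M ≡ k × Matching G M × TwoConnected (G -ᴱ M)
  grow zero    _   = [] , refl , record { edges = [] ; disjoint = [] } ,
    crossed⇒twoConnected (TwoConnected.atLeast3 tc)
      (crossed-mono {K = G} {K′ = G -ᴱ []} (λ rs → rs , (λ ()) , (λ ())) (twoConnected⇒crossed tc))
  grow (suc k) k<d with grow k (≤-trans (n≤1+n k) k<d)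
  ... | M , refl , mat , tcM = augment G d d≥5 (λ v → ≤-trans δ≥d (δ-min G v))
    (subst (λ e → d + e ≤ n) (+-identityʳ d) ∣V∣≥2d) M k<d mat tcM
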